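{- Let $p$ be a prime, $n$ a positive integer, $q=p^n$, and let $F:\mathbb{F}_q\to\mathbb{F}_q$ be a planar function. Then for all non-zero functions $G:\mathbb{F}_q\to\mathbb{F}_q$, \[ \deg_{\mathrm{alg}}(G\circ F)-\deg_{\mathrm{alg}}(G)\le \frac{n(p-1)}{2}. \]
   Context: A function $F:\mathbb{F}_q\to\mathbb{F}_q$ is planar if for every non-zero $\alpha\in\mathbb{F}_q$ the map $x\mapsto F(x+\alpha)-F(x)-F(\alpha)$ is a permutation of $\mathbb{F}_q$. For a non-negative integer $e$, $s_p(e)$ denotes the sum of the digits of the base-$p$ representation of $e$. Every function $H:\mathbb{F}_q\to\mathbb{F}_q$ has a unique interpolating polynomial $\sum_{i=0}^{q-1}a_iX^i$ with $a_i\in\mathbb{F}_q$; for non-zero $H$, its algebraic degree is $\deg_{\mathrm{alg}}(H)=\max\{s_p(i)\mid a_i\neq 0\}$. -}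

module Defs where

open import Level using (0ℓ)
open import Data.Nat using (ℕ; zero; suc; _⊔_; _%_; _/_)
import Data.Nat as ℕ
open import Data.Fin using (Fin; toℕ)
import Data.Fin as Fin
open import Data.Product using (∃; _,_)
open import Relation.Nullary using (¬_; yes; no)
open import Relation.Binary.PropositionalEquality using (_≡_)
open import Relation.Binary.Definitions using (DecidableEquality)
open import Algebra.Structures using (IsCommutativeRing)
open import Function.Bundles using (_↔_; Bijection)
open import Function.Definitions using (Bijective)

record FiniteField (q : ℕ) : Set₁ where
  infixl 6 _+_ _-_
  infixl 7 _*_
  field
    Carrier : Set
    _+_ _*_ : Carrier → Carrier → Carrier
    -_ : Carrier → Carrier
    0# 1# : Carrier
    isCommutativeRing : IsCommutativeRing _≡_ _+_ _*_ -_ 0# 1#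
    0≢1 : ¬ (0# ≡ 1#)
    inverse : ∀ x → ¬ (x ≡ 0#) → ∃ λ y → x * y ≡ 1#
    _≟_ : DecidableEquality Carrier
    enumeration : Fin q ↔ Carrier

  _-_ : Carrier → Carrier → Carrier
  x - y = x + (- y)

  _^_ : Carrier → ℕ → Carrier
  x ^ zero = 1#
  x ^ suc i = x * (x ^ i)

  Σ : ∀ {m} → (Fin m → Carrier) → Carrier
  Σ {zero} f = 0#
  Σ {suc m} f = f Fin.zero + Σ (λ i → f (Fin.suc i))

  Planar : (Carrier → Carrier) → Set
  Planar F = ∀ α → ¬ (α ≡ 0#) →
    Bijective {A = Carrier} {B = Carrier} _≡_ _≡_ (λ x → F (x + α) - F x - F α)

  -- a : Fin q → Carrier are the coefficients of the interpolating polynomial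
  -- Σ_{i=0}^{q-1} a_i X^i of H (this polynomial is unique)
  IsInterpolation : (Carrier → Carrier) → (Fin q → Carrier) → Set
  IsInterpolation H a = ∀ x → H x ≡ Σ (λ i → a i * (x ^ toℕ i))

  NonZeroFunction : (Carrier → Carrier) → Set
  NonZeroFunction H = ∃ λ x → ¬ (H x ≡ 0#)

digitSumFuel : ℕ → ℕ → ℕ → ℕ
digitSumFuel zero _ _ = 0
digitSumFuel (suc b) zero e = 0
digitSumFuel (suc b) (suc k) e = e % suc b ℕ.+ digitSumFuel (suc b) k (e / suc b)

-- s_p(e): sum of base-p digits of e (fuel e suffices for p ≥ 2)
s : ℕ → ℕ → ℕ
s p e = digitSumFuel p e e

maxFin : ∀ {m} → (Fin m → ℕ) → ℕ
maxFin {zero} f = 0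
maxFin {suc m} f = f Fin.zero ⊔ maxFin (λ i → f (Fin.suc i))

-- algebraic degree from the coefficient vector: max { s_p(i) | a_i ≠ 0 }
-- (for a non-zero coefficient vector; s_p ≥ 0 so zero coefficients contribute 0)
degAlg : ∀ {q} (K : FiniteField q) (p : ℕ) → (Fin q → FiniteField.Carrier K) → ℕ
degAlg K p a = maxFin (λ i → contrib (a i) i)
  where
  open FiniteField K
  contrib : Carrier → Fin _ → ℕ
  contrib c i with c ≟ 0#
  ... | yes _ = 0
  ... | no _ = s p (toℕ i)

{-# OPTIONS --safe #-}

-- Let u = -p and h = p - 1, and filter the group ring ℤ[K × K] by giving every [g] - 1 weight 1
-- and u weight h. Since ([g] - 1)^p ≡ u([g] - 1) in the associated graded ring, a symbol σ of
-- degree d satisfies σ^p = u^d σ; so, once f is admitted in degree d whenever some u^e f has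
-- weight d + e h, the graded ring has no nilpotents. Planarity says that the graph
-- W = Σ [x , F x] and its conjugate have product of weight n h, and conjugation acts on symbols
-- of degree d by (-1)^d; hence σ(W)² = 0 for as long as 2 d < n h, and W has weight at least n h / 2.
-- Integer lifts of F_p-coordinates are test functions which turn this weight into the vanishing of
-- Σ x^k F(x)^l whenever 2 (s(k) + s(l)) < n h. Finally the coefficient of x^i in G ∘ F is, up to
-- sign, Σ x^(q-1-i) G(F x), where s(q-1-i) = n h - s(i).

module Submission where

open import Defs
open import Level using (0ℓ)
open import Data.Nat as ℕ using (ℕ; zero; suc; _≤_; _<_; z≤n; s≤s; _∸_)
import Data.Nat.Properties as ℕ
import Data.Nat.DivMod as ℕ
import Data.Nat.Divisibility as ℕ∣
import Data.Nat.Tactic.RingSolver as ℕS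
open import Data.Nat.Combinatorics using (nCn≡1; nC1≡n; nCk+nC[k+1]≡[n+1]C[k+1]) renaming (_C_ to _choose_)
open import Data.Nat.Combinatorics.Specification using (k>n⇒nCk≡0)
open import Data.Nat.Coprimality using (Coprime; coprime-Bézout)
open import Data.Nat.GCD using (module Bézout)
open import Data.Nat.Primality using (Prime; euclidsLemma; prime⇒irreducible; ¬prime[0]; ¬prime[1])
open import Data.Integer as ℤ using (ℤ; +_; -[1+_]; _⊖_)
import Data.Integer.Properties as ℤ
import Data.Integer.DivMod as ℤ
open import Data.Integer.Divisibility.Signed using (_∣_; divides; _∣?_; ∣-refl; ∣-trans; ∣⇒∣ᵤ; ∣ᵤ⇒∣; ∣m∣n⇒∣m+n; ∣m∣n⇒∣m-n; ∣m⇒∣-m; ∣n⇒∣m*n; ∣m⇒∣m*n; *-monoʳ-∣; *-monoˡ-∣; *-cancelˡ-∣)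
open import Data.Integer.Tactic.RingSolver using (solve-∀)
open import Data.Fin as Fin using (Fin; zero; suc; toℕ; inject₁; fromℕ; punchIn)
import Data.Fin.Properties as Fin
open import Data.List using (List; []; _∷_; length)
import Data.Maybe as Maybe
open import Data.Product using (∃; Σ-syntax; _×_; _,_; proj₁; proj₂)
open import Data.Sum using (_⊎_; inj₁; inj₂)
open import Data.Unit using (⊤; tt)
open import Data.Empty using (⊥-elim)
open import Function using (_∘_)
open import Function.Bundles using (Inverse; mk↔ₛ′)
open import Relation.Nullary using (¬_; Dec; yes; no)
open import Relation.Nullary.Decidable using (map′; dec⇒maybe)
open import Relation.Binary.Definitions using (tri<; tri≈; tri>)
open import Relation.Binary.PropositionalEquality as ≡ using (_≡_; _≢_)
open import Algebra.Bundles using (AbelianGroup; CommutativeRing; CommutativeMonoid)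
open import Algebra.Structures using (IsAbelianGroup)
import Algebra.Properties.CommutativeMonoid.Sum as MonoidSum
import Algebra.Properties.CommutativeSemiring.Exp as Exp
import Algebra.Properties.Semiring.Mult as Mult
import Algebra.Properties.Semiring.Sum as SemiringSum
import Algebra.Solver.Ring
open import Algebra.Solver.Ring.AlmostCommutativeRing using (fromCommutativeRing; _-Raw-AlmostCommutative⟶_)


-- Over the prime field, `([g] - 1)^p = 0`, so every symbol of positive degree would be nilpotent
-- and a vanishing square would say nothing. Lifting to ℤ turns this into `T^p = u T + ...`, and
-- `p - 1` is the only weight of `u` that makes both sides homogeneous of weight `p`. Multiplication
-- by `u` can still kill symbols, hence the saturation. The price is paid by the test functions: a
-- weight bound on `u^e f` gives information about `f` modulo `p` only if the pairing is controlled
-- modulo `p^(e+1)`. Their degree is therefore measured by the divisibility of all iterated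
-- differences by powers of `p`. The graded ring is never formed; a statement about symbols is a
-- congruence modulo the next weight. The number `n h` is the weight of `q = p^n`: the sum over a
-- subgroup of order `q` squares to `q` times itself and inherits that weight, and `bar W` times `W`
-- is `q` plus one coset of the vertical axis for each non-zero difference. The sign rule for
-- conjugation needs `h` even, since `u` is fixed; the prime 2 is excluded because it admits no
-- planar functions.

-- Binomial coefficients at a prime.

[1+k]*[1+n]C[1+k]≡[1+n]*nCk : ∀ n k → suc k ℕ.* (suc n choose suc k) ≡ suc n ℕ.* (n choose k)
[1+k]*[1+n]C[1+k]≡[1+n]*nCk n zero = ≡.trans (ℕ.*-identityˡ _)
  (≡.trans (nC1≡n (suc n)) (≡.sym (ℕ.*-identityʳ _)))
[1+k]*[1+n]C[1+k]≡[1+n]*nCk zero (suc k) = ≡.trans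
  (≡.cong (suc (suc k) ℕ.*_) (k>n⇒nCk≡0 {1} {suc (suc k)} (s≤s (s≤s z≤n))))
  (≡.trans (ℕ.*-zeroʳ (suc (suc k)))
  (≡.sym (≡.trans (ℕ.*-identityˡ _) (k>n⇒nCk≡0 {0} {suc k} (s≤s z≤n)))))
[1+k]*[1+n]C[1+k]≡[1+n]*nCk (suc n) (suc k) = begin
  suc (suc k) ℕ.* (suc (suc n) choose suc (suc k))
    ≡⟨ ≡.cong (suc (suc k) ℕ.*_) (≡.sym (nCk+nC[k+1]≡[n+1]C[k+1] (suc n) (suc k))) ⟩
  suc (suc k) ℕ.* (a ℕ.+ (suc n choose suc (suc k)))
    ≡⟨ split k a (suc n choose suc (suc k)) ⟩
  a ℕ.+ (suc k ℕ.* a ℕ.+ suc (suc k) ℕ.* (suc n choose suc (suc k)))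
    ≡⟨ ≡.cong (a ℕ.+_) (≡.cong₂ ℕ._+_ ([1+k]*[1+n]C[1+k]≡[1+n]*nCk n k)
      ([1+k]*[1+n]C[1+k]≡[1+n]*nCk n (suc k))) ⟩
  a ℕ.+ (suc n ℕ.* (n choose k) ℕ.+ suc n ℕ.* (n choose suc k))
    ≡⟨ ≡.cong (a ℕ.+_) (≡.trans (≡.sym (ℕ.*-distribˡ-+ (suc n) (n choose k) _))
      (≡.cong (suc n ℕ.*_) (nCk+nC[k+1]≡[n+1]C[k+1] n k))) ⟩
  suc (suc n) ℕ.* a ∎
  where
  open ≡.≡-Reasoning
  a = suc n choose suc k
  split : ∀ k a b → suc (suc k) ℕ.* (a ℕ.+ b) ≡ a ℕ.+ (suc k ℕ.* a ℕ.+ suc (suc k) ℕ.* b)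
  split = ℕS.solve-∀

prime∣binomial : ∀ {n k} → Prime (suc n) → suc k < suc n → suc n ℕ∣.∣ (suc n choose suc k)
prime∣binomial {n} {k} pr k<n with euclidsLemma (suc k) (suc n choose suc k) pr
  (ℕ∣.divides (n choose k) (≡.trans ([1+k]*[1+n]C[1+k]≡[1+n]*nCk n k)
    (ℕ.*-comm (suc n) (n choose k))))
... | inj₁ d = ⊥-elim (ℕ.<⇒≱ k<n (ℕ∣.∣⇒≤ d))
... | inj₂ d = d

-- The canonical map from ℤ, used as the coefficient map of a ring solver.

module IntegerMorphism (R : CommutativeRing 0ℓ 0ℓ) where
  open CommutativeRing R hiding (zero)
  open Mult semiring using (×-homo-+) renaming (_×_ to _·_)
  open import Algebra.Properties.Ring ring using (-0#≈0#; -‿involutive; -‿distribʳ-*; -‿+-comm)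
  open import Relation.Binary.Reasoning.Setoid setoid

  ι : ℤ → Carrier
  ι (+ n) = n · 1#
  ι -[1+ n ] = - (suc n · 1#)

  ι-⊖ : ∀ m n → ι (m ⊖ n) ≈ m · 1# + - (n · 1#)
  ι-⊖ m zero = sym (trans (+-congˡ -0#≈0#) (+-identityʳ _))
  ι-⊖ zero (suc n) = sym (+-identityˡ _)
  ι-⊖ (suc m) (suc n) = begin
    ι (suc m ⊖ suc n)                 ≡⟨ ≡.cong ι (ℤ.[1+m]⊖[1+n]≡m⊖n m n) ⟩
    ι (m ⊖ n)                         ≈⟨ ι-⊖ m n ⟩
    a + - b
      ≈⟨ +-congʳ (trans (sym (+-identityˡ a)) (+-congʳ (sym (-‿inverseʳ 1#)))) ⟩
    (1# + - 1# + a) + - b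
      ≈⟨ +-congʳ (trans (+-assoc _ _ _) (trans (+-congˡ (+-comm _ _)) (sym (+-assoc _ _ _)))) ⟩
    (1# + a + - 1#) + - b             ≈⟨ +-assoc _ _ _ ⟩
    (1# + a) + (- 1# + - b)           ≈⟨ +-congˡ (-‿+-comm 1# b) ⟩
    (1# + a) + - (1# + b)             ∎
    where
    a = m · 1#
    b = n · 1#

  ι-neg : ∀ z → ι (ℤ.- z) ≈ - ι z
  ι-neg (+ zero) = sym -0#≈0#
  ι-neg (+ suc n) = refl
  ι-neg -[1+ n ] = sym (-‿involutive _)

  ι-+ : ∀ x y → ι (x ℤ.+ y) ≈ ι x + ι y
  ι-+ (+ m) (+ n) = ×-homo-+ 1# m n
  ι-+ (+ m) -[1+ n ] = ι-⊖ m (suc n)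
  ι-+ -[1+ m ] (+ n) = trans (ι-⊖ n (suc m)) (+-comm _ _)
  ι-+ -[1+ m ] -[1+ n ] = begin
    - (suc (suc (m ℕ.+ n)) · 1#)          ≡⟨ ≡.cong (λ k → - (k · 1#)) (≡.sym (ℕ.+-suc (suc m) n)) ⟩
    - ((suc m ℕ.+ suc n) · 1#)            ≈⟨ -‿cong (×-homo-+ 1# (suc m) (suc n)) ⟩
    - (suc m · 1# + suc n · 1#)           ≈⟨ -‿+-comm _ _ ⟨
    - (suc m · 1#) + - (suc n · 1#)       ∎

  ι-*-+ : ∀ x n → ι (x ℤ.* + n) ≈ ι x * ι (+ n)
  ι-*-+ x zero = trans (reflexive (≡.cong ι (ℤ.*-zeroʳ x))) (sym (zeroʳ _))
  ι-*-+ x (suc n) = begin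
    ι (x ℤ.* + suc n)           ≡⟨ ≡.cong ι (ℤ.*-suc x (+ n)) ⟩
    ι (x ℤ.+ x ℤ.* + n)         ≈⟨ ι-+ x (x ℤ.* + n) ⟩
    ι x + ι (x ℤ.* + n)         ≈⟨ +-cong (sym (*-identityʳ _)) (ι-*-+ x n) ⟩
    ι x * 1# + ι x * ι (+ n)    ≈⟨ distribˡ _ _ _ ⟨
    ι x * ι (+ suc n)           ∎

  ι-* : ∀ x y → ι (x ℤ.* y) ≈ ι x * ι y
  ι-* x (+ n) = ι-*-+ x n
  ι-* x -[1+ n ] = begin
    ι (x ℤ.* -[1+ n ])        ≡⟨ ≡.cong ι (≡.sym (ℤ.neg-distribʳ-* x (+ suc n))) ⟩
    ι (ℤ.- (x ℤ.* + suc n))   ≈⟨ ι-neg (x ℤ.* + suc n) ⟩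
    - ι (x ℤ.* + suc n)       ≈⟨ -‿cong (ι-*-+ x (suc n)) ⟩
    - (ι x * ι (+ suc n))     ≈⟨ -‿distribʳ-* _ _ ⟩
    ι x * - ι (+ suc n)       ∎

  morphism : ℤ.+-*-rawRing -Raw-AlmostCommutative⟶ fromCommutativeRing R
  morphism = record
    { ⟦_⟧ = ι ; +-homo = ι-+ ; *-homo = ι-* ; -‿homo = ι-neg
    ; 0-homo = refl ; 1-homo = +-identityʳ 1# }

  module Solver = Algebra.Solver.Ring ℤ.+-*-rawRing (fromCommutativeRing R) morphism
    (λ x y → Maybe.map (λ e → reflexive (≡.cong ι e)) (dec⇒maybe (x ℤ.≟ y)))

-- Expansions of p-th powers.

module PrimeBinomial (R : CommutativeRing 0ℓ 0ℓ) where
  open CommutativeRing R hiding (zero)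
  open Exp commutativeSemiring using (_^_; ^-congˡ; ^-congʳ)
  open Mult semiring using (×-congˡ; ×-assocˡ; ×-assoc-*; ×-congʳ; ×-homo-1) renaming (_×_ to _·_)
  open import Algebra.Properties.Semiring.Sum semiring using (sum; sum-init-last)
  open import Algebra.Properties.CommutativeSemiring.Binomial commutativeSemiring using (theorem; binomialTerm)
  open import Relation.Binary.Reasoning.Setoid setoid

  -- `P` carries whatever must be known about the cofactor of `p`: divisibility by a square, a
  -- weight, or nothing at all. One expansion thus serves `unipotent-^p`, `Fil-freshman` and the
  -- Frobenius map of the field.
  module _ (P : Carrier → Set) (P-0 : P 0#) (P-+ : ∀ {x y} → P x → P y → P (x + y)) where

    closed-· : ∀ n {x} → P x → P (n · x)
    closed-· zero Px = P-0
    closed-· (suc n) Px = P-+ Px (closed-· n Px)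

    sum-multiples : ∀ π {n} (t : Fin n → Carrier) → (∀ i → ∃ λ c → P c × t i ≈ π * c) →
      ∃ λ c → P c × sum t ≈ π * c
    sum-multiples π {zero} t m = 0# , P-0 , sym (zeroʳ π)
    sum-multiples π {suc n} t m with m zero | sum-multiples π (λ i → t (suc i)) (λ i → m (suc i))
    ... | c , Pc , e | c′ , Pc′ , e′ = c + c′ , P-+ Pc Pc′ , trans (+-cong e e′)
      (sym (distribˡ π c c′))

    -- The term k = 1 is kept apart because unipotent-^p needs its exact coefficient.
    binomial-prime : ∀ m (let p = suc (suc m)) → Prime p → ∀ x y →
      (∀ k → 2 ≤ k → k < p → P (x ^ k * y ^ (p ∸ k))) →
      ∃ λ c → P c × (x + y) ^ p ≈ y ^ p + ((p · 1#) * (x * y ^ suc m) + ((p · 1#) * c + x ^ p))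
    binomial-prime m pr x y H = c , Pc , (begin
      (x + y) ^ p   ≈⟨ theorem p x y ⟩
      t 0F + (t 1F + sum t″) ≈⟨ +-cong t₀ (+-cong t₁ (trans (sum-init-last t″) (+-cong e last≈))) ⟩
      y ^ p + ((p · 1#) * (x * y ^ suc m) + ((p · 1#) * c + x ^ p)) ∎)
      where
      p = suc (suc m)
      0F : Fin (suc p)
      0F = zero
      1F : Fin (suc p)
      1F = suc zero
      t = binomialTerm x y p
      t″ : Fin (suc m) → Carrier
      t″ i = t (suc (suc i))
      pull : ∀ n z → n · z ≈ (n · 1#) * z
      pull n z = trans (×-congʳ n (sym (*-identityˡ z))) (sym (×-assoc-* n 1# z))
      term : ∀ k → 2 ≤ k → k < p → ∃ λ c → P c × (p choose k) · (x ^ k * y ^ (p ∸ k)) ≈ (p · 1#) * c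
      term (suc k) 2≤k k<p with prime∣binomial pr k<p
      ... | ℕ∣.divides q eq = q · z , closed-· q (H (suc k) 2≤k k<p) , (begin
        (p choose suc k) · z ≈⟨ ×-congˡ (≡.trans eq (ℕ.*-comm q p)) ⟩
        (p ℕ.* q) · z   ≈⟨ ×-assocˡ z p q ⟨
        p · (q · z)     ≈⟨ pull p (q · z) ⟩
        (p · 1#) * (q · z) ∎)
        where z = x ^ suc k * y ^ (p ∸ suc k)
      mid = sum-multiples (p · 1#) (λ i → t″ (inject₁ i)) (λ i →
        term (suc (suc (toℕ (inject₁ i)))) (s≤s (s≤s z≤n))
          (s≤s (s≤s (≡.subst (_< m) (≡.sym (Fin.toℕ-inject₁ i)) (Fin.toℕ<n i)))))
      c = proj₁ mid
      Pc = proj₁ (proj₂ mid)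
      e = proj₂ (proj₂ mid)
      t₀ : t 0F ≈ y ^ p
      t₀ = trans (×-homo-1 _) (*-identityˡ _)
      t₁ : t 1F ≈ (p · 1#) * (x * y ^ suc m)
      t₁ = trans (×-congˡ (nC1≡n p)) (trans (×-congʳ p (*-congʳ (*-identityʳ x))) (pull p _))
      last≈ : t″ (fromℕ m) ≈ x ^ p
      last≈ = at (≡.cong (λ k → suc (suc k)) (Fin.toℕ-fromℕ m))
        where
        at : ∀ {k} → k ≡ p → (p choose k) · (x ^ k * y ^ (p ∸ k)) ≈ x ^ p
        at ≡.refl = trans (×-congˡ (nCn≡1 p))
          (trans (×-homo-1 _) (trans (*-congˡ (^-congʳ y (ℕ.n∸n≡0 p))) (*-identityʳ _)))

  open IntegerMorphism.Solver R using (solve; _:=_; _:+_; _:*_; :-_)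

  -- Expand `E ^ p = (T + 1) ^ p` and compare with 1: what remains is `T ^ p = - p T - p c`. Only
  -- terms with `k ≥ 2` enter `c`, so it is a multiple of `T * T`, and `u * T` is the leading term.
  unipotent-^p : ∀ m (let p = suc (suc m)) → Prime p → ∀ E → E ^ p ≈ 1# →
    let T = E + - 1#; u = - (p · 1#) in
    ∃ λ v → T ^ p ≈ u * T + u * (T * T * v)
  unipotent-^p m p-prime E E^p≈1 = v , (begin
    T ^ p
      ≈⟨ lem (T ^ p) π T c 1# ⟩
    ((1# + (π * T + (π * c + T ^ p))) + - 1#) + ((- π) * T + (- π) * c)
      ≈⟨ +-congʳ (+-congʳ 1≈) ⟩
    (1# + - 1#) + ((- π) * T + (- π) * c)
      ≈⟨ trans (+-congʳ (-‿inverseʳ 1#)) (+-identityˡ _) ⟩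
    (- π) * T + (- π) * c
      ≈⟨ +-congˡ (*-congˡ c≈) ⟩
    (- π) * T + (- π) * (T * T * v)                                          ∎)
    where
    p = suc (suc m)
    T = E + - 1#
    π = p · 1#
    Multiple : Carrier → Set
    Multiple c = ∃ λ v → c ≈ T * T * v
    multiple : ∀ k → 2 ≤ k → k < p → Multiple (T ^ k * 1# ^ (p ∸ k))
    multiple (suc zero) (s≤s ()) _
    multiple (suc (suc k)) _ _ = _ , assoc₄ T (T ^ k) (1# ^ (p ∸ suc (suc k)))
      where
      assoc₄ : ∀ t a b → t * (t * a) * b ≈ t * t * (a * b)
      assoc₄ = solve 3 (λ t a b → t :* (t :* a) :* b := t :* t :* (a :* b)) refl
    expansion = binomial-prime Multiple (0# , sym (zeroʳ _))
      (λ (v , e) (w , e′) → v + w , trans (+-cong e e′) (sym (distribˡ _ v w))) m p-prime T 1#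
        multiple
    c = proj₁ expansion
    v = proj₁ (proj₁ (proj₂ expansion))
    c≈ = proj₂ (proj₁ (proj₂ expansion))
    1^ : ∀ n → 1# ^ n ≈ 1#
    1^ zero = refl
    1^ (suc n) = trans (*-identityˡ _) (1^ n)
    T+1≈E : T + 1# ≈ E
    T+1≈E = trans (+-assoc _ _ _) (trans (+-congˡ (-‿inverseˡ 1#)) (+-identityʳ E))
    1≈ : 1# + (π * T + (π * c + T ^ p)) ≈ 1#
    1≈ = trans (+-cong (sym (1^ p))
      (+-congʳ (*-congˡ (sym (trans (*-congˡ (1^ (suc m))) (*-identityʳ T))))))
      (trans (sym (proj₂ (proj₂ expansion))) (trans (^-congˡ p T+1≈E) E^p≈1))
    lem : ∀ t π T c o → t ≈ ((o + (π * T + (π * c + t))) + - o) + ((- π) * T + (- π) * c)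
    lem = solve 5 (λ t π T c o → t := ((o :+ (π :* T :+ (π :* c :+ t))) :+ :- o) :+
      ((:- π) :* T :+ (:- π) :* c)) refl

-- The weight filtration and its saturation.

module Filtration (R : CommutativeRing 0ℓ 0ℓ) (m : ℕ) (p-prime : Prime (suc (suc m))) where
  open CommutativeRing R hiding (zero)
  open Exp commutativeSemiring
  open Mult semiring using () renaming (_×_ to _·_)

  private
    h p : ℕ
    h = suc m
    p = suc h

  u : Carrier
  u = - (p · 1#)

  module Generated (I : Set) (T v : I → Carrier)
    (T^p : ∀ i → T i ^ p ≈ u * T i + u * (T i * T i * v i)) where

    open import Relation.Binary.Reasoning.Setoid setoid
    open import Algebra.Properties.Ring ring using (-‿distribˡ-*; -‿involutive; -1*x≈-x)
    open IntegerMorphism.Solver R using (solve; _:=_; _:+_; _:*_; :-_)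

    -- The smallest decreasing multiplicative filtration with the prescribed weights, given by
    -- derivations instead of powers of an ideal. Facts about weights are then inductions with one
    -- case per generator. The index is a lower bound for the weight, not its exact value.
    data Fil : ℕ → Carrier → Set where
      all  : ∀ f → Fil 0 f
      plus : ∀ {d f g} → Fil d f → Fil d g → Fil d (f + g)
      gen  : ∀ i {d f} → Fil d f → Fil (suc d) (T i * f)
      unif : ∀ {d f} → Fil d f → Fil (h ℕ.+ d) (u * f)
      ext  : ∀ {d f g} → f ≈ g → Fil d f → Fil d g
      weak : ∀ {d e f} → d ≤ e → Fil e f → Fil d f

    cast : ∀ {d e f} → d ≡ e → Fil d f → Fil e f
    cast ≡.refl F = F

    Fil-scale : ∀ {d g} f → Fil d g → Fil d (f * g)
    Fil-scale f (all g) = all (f * g)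
    Fil-scale f (plus G H) = ext (sym (distribˡ f _ _)) (plus (Fil-scale f G) (Fil-scale f H))
    Fil-scale f (gen i {f = g} G) = ext (swap (T i) f g) (gen i (Fil-scale f G))
      where
      swap : ∀ a b c → a * (b * c) ≈ b * (a * c)
      swap = solve 3 (λ a b c → a :* (b :* c) := b :* (a :* c)) refl
    Fil-scale f (unif {f = g} G) = ext (swap u f g) (unif (Fil-scale f G))
      where
      swap : ∀ a b c → a * (b * c) ≈ b * (a * c)
      swap = solve 3 (λ a b c → a :* (b :* c) := b :* (a :* c)) refl
    Fil-scale f (ext e G) = ext (*-congˡ e) (Fil-scale f G)
    Fil-scale f (weak l G) = weak l (Fil-scale f G)

    Fil-* : ∀ {a b f g} → Fil a f → Fil b g → Fil (a ℕ.+ b) (f * g)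
    Fil-* (all f) G = Fil-scale f G
    Fil-* (plus F F′) G = ext (sym (distribʳ _ _ _)) (plus (Fil-* F G) (Fil-* F′ G))
    Fil-* (gen i F) G = ext (sym (*-assoc _ _ _)) (gen i (Fil-* F G))
    Fil-* {b = b} (unif {d} F) G = cast (≡.sym (ℕ.+-assoc h d b))
      (ext (sym (*-assoc _ _ _)) (unif (Fil-* F G)))
    Fil-* (ext e F) G = ext (*-congʳ e) (Fil-* F G)
    Fil-* {b = b} (weak l F) G = weak (ℕ.+-monoˡ-≤ b l) (Fil-* F G)

    Fil-neg : ∀ {d f} → Fil d f → Fil d (- f)
    Fil-neg {f = f} F = ext (-1*x≈-x f) (Fil-scale (- 1#) F)

    -- Zero becomes arbitrarily deep through `u * 0#`, which gains `h ≥ 1` each time.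
    Fil-0 : ∀ d → Fil d 0#
    Fil-0 zero = all 0#
    Fil-0 (suc d) = weak (ℕ.m≤n+m (suc d) m)
      (cast (≡.sym (ℕ.+-suc m d)) (ext (zeroʳ u) (unif (Fil-0 d))))

    Fil-^ : ∀ k {d f} → Fil d f → Fil (k ℕ.* d) (f ^ k)
    Fil-^ zero F = all _
    Fil-^ (suc k) F = Fil-* F (Fil-^ k F)

    Fil-u^ : ∀ k {d f} → Fil d f → Fil (k ℕ.* h ℕ.+ d) (u ^ k * f)
    Fil-u^ zero F = ext (sym (*-identityˡ _)) F
    Fil-u^ (suc k) {d} F = cast (≡.sym (ℕ.+-assoc h (k ℕ.* h) d))
      (ext (sym (*-assoc _ _ _)) (unif (Fil-u^ k F)))

    Fil-T : ∀ i → Fil 1 (T i)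
    Fil-T i = ext (*-identityʳ _) (gen i (all 1#))

    Fil-π : ∀ {d f} → Fil d f → Fil (h ℕ.+ d) ((p · 1#) * f)
    Fil-π {d} {f} F = ext (trans (-‿distribˡ-* u f) (*-congʳ (-‿involutive _))) (Fil-neg (unif F))

    Fil-T^p : ∀ i → Fil (suc p) (T i ^ p + - (u * T i))
    Fil-T^p i = cast (ℕ.+-comm h 2)
      (ext (sym eq) (unif (Fil-* (Fil-* (Fil-T i) (Fil-T i)) (all (v i)))))
      where
      lem : ∀ a b → a + b + - a ≈ b
      lem = solve 2 (λ a b → a :+ b :+ :- a := b) refl
      eq : T i ^ p + - (u * T i) ≈ u * (T i * T i * v i)
      eq = trans (+-congʳ (T^p i)) (lem _ _)

    -- One factor `T ^ h` next to a further `T` is traded for `u * (1 + T v)`. This is what later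
    -- makes `1 + k h` differences in one direction divisible by `p ^ k`.
    T^[1+kh] : ∀ i k → ∃ λ w → T i ^ suc (k ℕ.* h) ≈ u ^ k * w * T i
    T^[1+kh] i zero = 1# , trans (*-identityʳ (T i))
      (sym (trans (*-congʳ (*-identityʳ 1#)) (*-identityˡ (T i))))
    T^[1+kh] i (suc k) = w * (1# + T i * v i) , (begin
      T i ^ suc (h ℕ.+ k ℕ.* h)
        ≈⟨ ^-congʳ (T i) (≡.sym (ℕ.+-suc h (k ℕ.* h))) ⟩
      T i ^ (h ℕ.+ suc (k ℕ.* h))                        ≈⟨ ^-homo-* (T i) h (suc (k ℕ.* h)) ⟩
      T i ^ h * T i ^ suc (k ℕ.* h)                      ≈⟨ *-congˡ (proj₂ (T^[1+kh] i k)) ⟩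
      T i ^ h * (u ^ k * w * T i)                        ≈⟨ lem₁ (T i) (T i ^ h) (u ^ k) w ⟩
      u ^ k * w * T i ^ p
        ≈⟨ *-congˡ (trans (T^p i) (+-congʳ (*-congˡ (sym (*-identityʳ (T i)))))) ⟩
      u ^ k * w * (u * (T i * 1#) + u * (T i * T i * v i)) ≈⟨ lem₂ (u ^ k) w u (T i) (v i) 1# ⟩
      u ^ suc k * (w * (1# + T i * v i)) * T i           ∎)
      where
      w = proj₁ (T^[1+kh] i k)
      lem₁ : ∀ T t z w → t * (z * w * T) ≈ z * w * (T * t)
      lem₁ = solve 4 (λ T t z w → t :* (z :* w :* T) := z :* w :* (T :* t)) refl
      lem₂ : ∀ z w u T v o → z * w * (u * (T * o) + u * (T * T * v)) ≈ u * z * (w * (o + T * v)) * T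
      lem₂ = solve 6 (λ z w u T v o → z :* w :* (u :* (T :* o) :+ u :* (T :* T :* v)) := u :* z :*
        (w :* (o :+ T :* v)) :* T) refl

    -- The mixed terms have weight `p d` like the pure powers, and in addition a factor `p`, which
    -- is worth `h ≥ 1`.
    Fil-freshman : ∀ {d f g} → Fil d f → Fil d g →
      Fil (suc (p ℕ.* d)) ((f + g) ^ p + - (f ^ p + g ^ p))
    Fil-freshman {d} {f} {g} F G = weak (ℕ.+-monoˡ-≤ (p ℕ.* d) (s≤s {0} {m} z≤n))
      (ext (sym eq) (Fil-π (plus Fc Fg)))
      where
      mixed : ∀ k → k ≤ p → Fil (p ℕ.* d) (f ^ k * g ^ (p ∸ k))
      mixed k k≤p = cast (≡.trans (≡.sym (ℕ.*-distribʳ-+ d k (p ∸ k)))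
        (≡.cong (ℕ._* d) (ℕ.m+[n∸m]≡n k≤p)))
        (Fil-* (Fil-^ k F) (Fil-^ (p ∸ k) G))
      expansion = PrimeBinomial.binomial-prime R (Fil (p ℕ.* d)) (Fil-0 _) plus m p-prime f g
        (λ k _ k<p → mixed k (ℕ.<⇒≤ k<p))
      c = proj₁ expansion
      Fc = proj₁ (proj₂ expansion)
      Fg : Fil (p ℕ.* d) (f * g ^ h)
      Fg = ext (*-congʳ (*-identityʳ f)) (mixed 1 (s≤s z≤n))
      lem : ∀ a b π x c → a + (π * x + (π * c + b)) + - (b + a) ≈ π * (c + x)
      lem = solve 5 (λ a b π x c → a :+ (π :* x :+ (π :* c :+ b)) :+ :- (b :+ a) := π :* (c :+ x))
        refl
      eq : (f + g) ^ p + - (f ^ p + g ^ p) ≈ (p · 1#) * (c + f * g ^ h)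
      eq = trans (+-congʳ (proj₂ (proj₂ expansion))) (lem _ _ _ _ _)

    module Saturation (base : ∀ f → Fil 1 (f ^ p + - f)) where

      -- Both terms have weight at least `p d = d h + d`, so the content is that they agree to
      -- leading order. Sums are handled by `Fil-freshman`, the generators by `Fil-T^p`, and weight
      -- 0 by `base`.
      frobenius : ∀ {d f} → Fil d f → Fil (suc (p ℕ.* d)) (f ^ p + - (u ^ d * f))
      frobenius (all f) = cast (≡.cong suc (≡.sym (ℕ.*-zeroʳ p)))
        (ext (+-congˡ (-‿cong (sym (*-identityˡ f)))) (base f))
      frobenius {d} (plus {f = f} {g} F G) =
        ext (lem (f ^ p) (g ^ p) ((f + g) ^ p) (u ^ d) f g)
          (plus (plus (frobenius F) (frobenius G)) (Fil-freshman F G))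
        where
        lem : ∀ a b c w f g → (a + - (w * f)) + (b + - (w * g)) + (c + - (a + b)) ≈ c + -
          (w * (f + g))
        lem = solve 6 (λ a b c w f g → (a :+ :- (w :* f)) :+ (b :+ :- (w :* g)) :+
          (c :+ :- (a :+ b)) := c :+ :- (w :* (f :+ g))) refl
      frobenius (gen i {d} {f} F) = ext
        (trans (lem (T i ^ p) (f ^ p) (u ^ d) f u (T i)) (+-congʳ (sym (^-distrib-* (T i) f p))))
        (plus (cast (e₁ h d) (Fil-* (Fil-^ p (Fil-T i)) (frobenius F)))
              (cast (e₂ h d) (Fil-* (Fil-T^p i) (Fil-u^ d F))))
        where
        e₁ : ∀ h d → suc h ℕ.* 1 ℕ.+ suc (suc h ℕ.* d) ≡ suc (suc h ℕ.* suc d)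
        e₁ = ℕS.solve-∀
        e₂ : ∀ h d → suc (suc h) ℕ.+ (d ℕ.* h ℕ.+ d) ≡ suc (suc h ℕ.* suc d)
        e₂ = ℕS.solve-∀
        lem : ∀ t a w f u T → t * (a + - (w * f)) + (t + - (u * T)) * (w * f) ≈ t * a + -
          (u * w * (T * f))
        lem = solve 6 (λ t a w f u T → t :* (a :+ :- (w :* f)) :+ (t :+ :- (u :* T)) :* (w :* f) :=
          t :* a :+ :- (u :* w :* (T :* f))) refl
      frobenius (unif {d} {f} F) = ext
        (trans (lem (u ^ p) (f ^ p) (u ^ d) f)
        (+-cong (sym (^-distrib-* u f p)) (-‿cong (trans (*-congʳ reorder) (*-assoc _ u f)))))
        (cast (e h d) (Fil-u^ p (frobenius F)))
        where
        e : ∀ h d → suc h ℕ.* h ℕ.+ suc (suc h ℕ.* d) ≡ suc (suc h ℕ.* (h ℕ.+ d))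
        e = ℕS.solve-∀
        lem : ∀ x a w f → x * (a + - (w * f)) ≈ x * a + - (x * w * f)
        lem = solve 4 (λ x a w f → x :* (a :+ :- (w :* f)) := x :* a :+ :- (x :* w :* f)) refl
        reorder : u ^ p * u ^ d ≈ u ^ (h ℕ.+ d) * u
        reorder = trans (sym (^-homo-* u p d)) (*-comm u _)
      frobenius {d} (ext e F) = ext (+-cong (^-congˡ p e) (-‿cong (*-congˡ e))) (frobenius F)
      frobenius {d} {f} (weak {e = e} d≤e F) with ℕ.m≤n⇒m<n∨m≡n d≤e
      ... | inj₂ ≡.refl = frobenius F
      -- A bound strictly better than `d` makes each of the two terms separately deeper than `p d`;
      -- nothing has to cancel.
      ... | inj₁ d<e = plus
        (weak (ℕ.≤-trans (ℕ.≤-trans (s≤s (ℕ.m≤n+m (p ℕ.* d) h))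
          (ℕ.≤-reflexive (≡.sym (ℕ.*-suc p d)))) (ℕ.*-monoʳ-≤ p d<e)) (Fil-^ p F))
        (Fil-neg (weak (ℕ.≤-trans (ℕ.≤-reflexive (e₂ h d)) (ℕ.+-monoʳ-≤ (d ℕ.* h) d<e))
          (Fil-u^ d F)))
        where
        e₂ : ∀ h d → suc (suc h ℕ.* d) ≡ d ℕ.* h ℕ.+ suc d
        e₂ = ℕS.solve-∀

      Sat : ℕ → Carrier → Set
      Sat d f = ∃ λ e → Fil (d ℕ.+ e ℕ.* h) (u ^ e * f)

      Fil⇒Sat : ∀ {d f} → Fil d f → Sat d f
      Fil⇒Sat F = 0 , cast (≡.sym (ℕ.+-identityʳ _)) (ext (sym (*-identityˡ _)) F)

      raise : ∀ {d f} k e → Fil (d ℕ.+ e ℕ.* h) (u ^ e * f) → Fil (d ℕ.+ (k ℕ.+ e) ℕ.* h)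
        (u ^ (k ℕ.+ e) * f)
      raise {d} k e F = cast (eq h d k e)
        (ext (trans (sym (*-assoc _ _ _)) (*-congʳ (sym (^-homo-* u k e)))) (Fil-u^ k F))
        where
        eq : ∀ h d k e → k ℕ.* h ℕ.+ (d ℕ.+ e ℕ.* h) ≡ d ℕ.+ (k ℕ.+ e) ℕ.* h
        eq = ℕS.solve-∀

      Sat-ext : ∀ {d f g} → f ≈ g → Sat d f → Sat d g
      Sat-ext eq (e , F) = e , ext (*-congˡ eq) F

      Sat-weak : ∀ {d e f} → d ≤ e → Sat e f → Sat d f
      Sat-weak le (e , F) = e , weak (ℕ.+-monoˡ-≤ (e ℕ.* h) le) F

      Sat-+ : ∀ {d f g} → Sat d f → Sat d g → Sat d (f + g)
      Sat-+ {d} {f} {g} (a , F) (b , G) = a ℕ.+ b , ext (sym (distribˡ _ _ _))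
        (plus (≡.subst (λ k → Fil (d ℕ.+ k ℕ.* h) (u ^ k * f)) (ℕ.+-comm b a) (raise b a F))
          (raise a b G))

      Sat-* : ∀ {d e f g} → Sat d f → Sat e g → Sat (d ℕ.+ e) (f * g)
      Sat-* {d} {e} {f} {g} (a , F) (b , G) = a ℕ.+ b , cast (eq d e a b h)
        (ext (trans (lem (u ^ a) (u ^ b) f g) (*-congʳ (sym (^-homo-* u a b)))) (Fil-* F G))
        where
        eq : ∀ d e a b h → d ℕ.+ a ℕ.* h ℕ.+ (e ℕ.+ b ℕ.* h) ≡ d ℕ.+ e ℕ.+ (a ℕ.+ b) ℕ.* h
        eq = ℕS.solve-∀
        lem : ∀ x y f g → (x * f) * (y * g) ≈ (x * y) * (f * g)
        lem = solve 4 (λ x y f g → (x :* f) :* (y :* g) := (x :* y) :* (f :* g)) refl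

      Sat-scale : ∀ {d f} g → Sat d f → Sat d (g * f)
      Sat-scale g F = Sat-* (Fil⇒Sat (all g)) F

      Sat-neg : ∀ {d f} → Sat d f → Sat d (- f)
      Sat-neg F = Sat-ext (-1*x≈-x _) (Sat-scale (- 1#) F)

      -- After clearing denominators `g ^ p` contains the factor `g * g` and so lies deeper than
      -- `p D`. By `frobenius` the same holds for `u ^ D * g`, and saturation strips the power of
      -- `u`.
      Sat-sq : ∀ {d f} → Sat d f → Sat (suc (d ℕ.+ d)) (f * f) → Sat (suc d) f
      Sat-sq {d} {f} (a , F) (b , G) = D ℕ.+ e , cast (e₃ h d e)
        (ext (trans (sym (*-assoc _ _ _)) (*-congʳ (sym (^-homo-* u D e)))) F-uD)
        where
        -- A common exponent at which the bounds for `f` and for `f * f` both become bounds in `Fil`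
        -- itself.
        e = b ℕ.+ a
        D = d ℕ.+ e ℕ.* h
        g = u ^ e * f
        Fg : Fil D g
        Fg = raise b a F
        e₁ : ∀ h d a b → (a ℕ.+ (b ℕ.+ a)) ℕ.* h ℕ.+ (suc (d ℕ.+ d) ℕ.+ b ℕ.* h) ≡ suc
          ((d ℕ.+ (b ℕ.+ a) ℕ.* h) ℕ.+ (d ℕ.+ (b ℕ.+ a) ℕ.* h))
        e₁ = ℕS.solve-∀
        e₂ : ∀ m D → m ℕ.* D ℕ.+ suc (D ℕ.+ D) ≡ suc (suc (suc m) ℕ.* D)
        e₂ = ℕS.solve-∀
        e₃ : ∀ h d e → suc (suc h ℕ.* (d ℕ.+ e ℕ.* h)) ≡ suc d ℕ.+ (d ℕ.+ e ℕ.* h ℕ.+ e) ℕ.* h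
        e₃ = ℕS.solve-∀
        lem : ∀ x y f → (y * (x * y)) * (x * (f * f)) ≈ ((x * y) * f) * ((x * y) * f)
        lem = solve 3 (λ x y f → (y :* (x :* y)) :* (x :* (f :* f)) := ((x :* y) :* f) :*
          ((x :* y) :* f)) refl
        Fg² : Fil (suc (D ℕ.+ D)) (g * g)
        Fg² = cast (e₁ h d a b) (ext eq (Fil-u^ (a ℕ.+ e) G))
          where
          split = ^-homo-* u b a
          eq : u ^ (a ℕ.+ e) * (u ^ b * (f * f)) ≈ g * g
          eq = trans (*-congʳ (trans (^-homo-* u a e) (*-congˡ split)))
            (trans (lem (u ^ b) (u ^ a) f) (*-cong (*-congʳ (sym split)) (*-congʳ (sym split))))
        F-uD : Fil (suc (p ℕ.* D)) (u ^ D * g)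
        F-uD = ext (lem₂ (g ^ p) (u ^ D * g))
          (plus (cast (e₂ m D) (ext (lem₃ (g ^ m) g) (Fil-* (Fil-^ m Fg) Fg²)))
            (Fil-neg (frobenius Fg)))
          where
          lem₂ : ∀ x y → x + - (x + - y) ≈ y
          lem₂ = solve 2 (λ x y → x :+ :- (x :+ :- y) := y) refl
          lem₃ : ∀ x y → x * (y * y) ≈ y * (y * x)
          lem₃ = solve 2 (λ x y → x :* (y :* y) := y :* (y :* x)) refl

      -- If `f` has weight `d < N`, then `f * f = c * f` has weight `N + d ≥ 2 d + 1`, and `Sat-sq`
      -- gains one step.
      Sat-idempotent : ∀ {N f c} → f * f ≈ c * f → Sat N c → ∀ d → d ≤ N → Sat d f
      Sat-idempotent ff Q zero _ = Fil⇒Sat (all _)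
      Sat-idempotent {f = f} ff Q (suc d) d<N = Sat-sq F
        (Sat-ext (sym ff) (Sat-weak (ℕ.+-monoˡ-≤ d d<N) (Sat-* Q F)))
        where F = Sat-idempotent ff Q d (ℕ.<⇒≤ d<N)

      -- The model is inversion of group elements, for which `T` goes to `- T` up to weight 2. As
      -- `u` is fixed but has weight `h`, the sign rule is consistent only for even `h`.
      module Involution
        (bar : Carrier → Carrier)
        (bar-cong : ∀ {f g} → f ≈ g → bar f ≈ bar g)
        (bar-+ : ∀ f g → bar (f + g) ≈ bar f + bar g)
        (bar-* : ∀ f g → bar (f * g) ≈ bar f * bar g)
        (bar-u : bar u ≈ u)
        (bar-T : ∀ i → ∃ λ j → bar (T i) ≈ - T i + - (T j * T i))
        (bar-base : ∀ f → Fil 1 (bar f + - f))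
        (half : ℕ) (h-even : h ≡ half ℕ.+ half) where

        sgn : ℕ → Carrier
        sgn d = (- 1#) ^ d

        sgn-double : ∀ k → sgn (k ℕ.+ k) ≈ 1#
        sgn-double zero = refl
        sgn-double (suc k) = trans
          (*-congˡ (trans (reflexive (≡.cong sgn (ℕ.+-suc k k))) (*-congˡ (sgn-double k))))
          (trans (solve 1 (λ x → :- x :* (:- x :* x) := x :* (x :* x)) refl 1#)
            (trans (*-identityˡ _) (*-identityˡ _)))

        sgn-h+ : ∀ d → sgn (h ℕ.+ d) ≈ sgn d
        sgn-h+ d = trans (^-homo-* (- 1#) h d)
          (trans (*-congʳ (trans (reflexive (≡.cong sgn h-even)) (sgn-double half)))
          (*-identityˡ _))

        sgn-*h+ : ∀ e d → sgn (e ℕ.* h ℕ.+ d) ≈ sgn d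
        sgn-*h+ zero d = refl
        sgn-*h+ (suc e) d = trans (reflexive (≡.cong sgn (ℕ.+-assoc h (e ℕ.* h) d)))
          (trans (sgn-h+ _) (sgn-*h+ e d))

        sgn² : ∀ d → sgn d * sgn d ≈ 1#
        sgn² d = trans (sym (^-homo-* (- 1#) d d)) (sgn-double d)

        -- The two statements need each other: the error term `T j * T i` in `bar-T` is multiplied
        -- by `bar f`, for which membership in weight `d` must already be known.
        Fil-bar : ∀ {d f} → Fil d f → Fil (suc d) (bar f + - (sgn d * f))
        Fil-bar-closed : ∀ {d f} → Fil d f → Fil d (bar f)

        Fil-bar (all f) = ext (+-congˡ (-‿cong (sym (*-identityˡ f)))) (bar-base f)
        Fil-bar {d} (plus {f = f} {g} F G) = ext (trans (lem _ _ _ f g) (+-congʳ (sym (bar-+ f g))))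
          (plus (Fil-bar F) (Fil-bar G))
          where
          lem : ∀ a b s f g → (a + - (s * f)) + (b + - (s * g)) ≈ (a + b) + - (s * (f + g))
          lem = solve 5 (λ a b s f g → (a :+ :- (s :* f)) :+ (b :+ :- (s :* g)) := (a :+ b) :+ :-
            (s :* (f :+ g))) refl
        Fil-bar (gen i {d} {f} F) with bar-T i
        ... | j , eq = ext (trans (lem (T i) (T j) (bar f) (sgn d) f 1#)
            (+-cong (trans (*-congʳ (sym eq)) (sym (bar-* (T i) f)))
              (-‿cong (*-congʳ (*-congʳ (-‿cong refl))))))
          (Fil-neg (plus (gen i (ext (+-congˡ (-‿cong (*-congʳ (sym (*-identityˡ _)))))
            (Fil-bar F))) (gen j (gen i (Fil-bar-closed F)))))
          where
          lem : ∀ t t′ b s f o → - (t * (b + - (o * s * f)) + t′ * (t * b)) ≈ (- t + - (t′ * t)) * b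
            + - (- o * s * (t * f))
          lem = solve 6 (λ t t′ b s f o → :- (t :* (b :+ :- (o :* s :* f)) :+ t′ :* (t :* b)) :=
            (:- t :+ :- (t′ :* t)) :* b :+ :- (:- o :* s :* (t :* f))) refl
        Fil-bar (unif {d} {f} F) = ext
          (trans (lem u (bar f) (sgn d) f)
            (+-cong (trans (*-congʳ (sym bar-u)) (sym (bar-* u f)))
            (-‿cong (*-congʳ (sym (sgn-h+ d))))))
          (cast (ℕ.+-suc h d) (unif (Fil-bar F)))
          where
          lem : ∀ u b s f → u * (b + - (s * f)) ≈ u * b + - (s * (u * f))
          lem = solve 4 (λ u b s f → u :* (b :+ :- (s :* f)) := u :* b :+ :- (s :* (u :* f))) refl
        Fil-bar (ext e F) = ext (+-cong (bar-cong e) (-‿cong (*-congˡ e))) (Fil-bar F)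
        Fil-bar {d} (weak d≤e F) with ℕ.m≤n⇒m<n∨m≡n d≤e
        ... | inj₂ ≡.refl = Fil-bar F
        ... | inj₁ d<e = weak d<e (plus (Fil-bar-closed F) (Fil-neg (Fil-scale (sgn d) F)))

        Fil-bar-closed {d} {f} F = ext
          (solve 2 (λ a b → (a :+ :- b) :+ b := a) refl (bar f) (sgn d * f))
          (plus (weak (ℕ.n≤1+n d) (Fil-bar F)) (Fil-scale (sgn d) F))

        Sat-bar : ∀ {d f} → Sat d f → Sat (suc d) (bar f + - (sgn d * f))
        Sat-bar {d} {f} (e , F) = e , ext eq (Fil-bar F)
          where
          bar-u^ : ∀ e → bar (u ^ e * f) ≈ u ^ e * bar f
          bar-u^ zero = trans (bar-cong (*-identityˡ f)) (sym (*-identityˡ _))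
          bar-u^ (suc e) = trans (bar-cong (*-assoc _ _ _))
            (trans (bar-* _ _) (trans (*-cong bar-u (bar-u^ e)) (sym (*-assoc _ _ _))))
          lem : ∀ x b s f → x * b + - (s * (x * f)) ≈ x * (b + - (s * f))
          lem = solve 4 (λ x b s f → x :* b :+ :- (s :* (x :* f)) := x :* (b :+ :- (s :* f))) refl
          eq : bar (u ^ e * f) + - (sgn (d ℕ.+ e ℕ.* h) * (u ^ e * f)) ≈ u ^ e *
            (bar f + - (sgn d * f))
          eq = trans (+-cong (bar-u^ e)
            (-‿cong (*-congʳ (trans (reflexive (≡.cong sgn (ℕ.+-comm d (e ℕ.* h))))
            (sgn-*h+ e d))))) (lem _ _ _ _)

        -- Write `f * f` as `σ * (bar f * f)` minus `σ * ((bar f - σ f) * f)`. Passing from `d` to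
        -- `d + 1` requires both to have weight `2 d + 1`: the first does as long as `2 d + 1 ≤ N`,
        -- the second by `Sat-bar`. Hence the bound `suc N` on the doubled degree.
        Sat-norm : ∀ {N f} → Sat N (bar f * f) → ∀ d → d ℕ.+ d ≤ suc N → Sat d f
        Sat-norm B zero _ = Fil⇒Sat (all _)
        Sat-norm {N} {f} B (suc d) le = Sat-sq F
          (Sat-ext eq (Sat-+ (Sat-scale σ (Sat-weak le′ B))
            (Sat-neg (Sat-scale σ (Sat-* (Sat-bar F) F)))))
          where
          le′ : suc (d ℕ.+ d) ≤ N
          le′ = ≡.subst (_≤ N) (ℕ.+-suc d d) (ℕ.s≤s⁻¹ le)
          σ = sgn d
          F = Sat-norm B d (ℕ.≤-trans (ℕ.n≤1+n _) (ℕ.≤-trans le′ (ℕ.n≤1+n N)))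
          lem : ∀ s b f → s * (b * f) + - (s * ((b + - (s * f)) * f)) ≈ (s * s) * (f * f)
          lem = solve 3 (λ s b f → s :* (b :* f) :+ :- (s :* ((b :+ :- (s :* f)) :* f)) := (s :* s)
            :* (f :* f)) refl
          eq : σ * (bar f * f) + - (σ * ((bar f + - (σ * f)) * f)) ≈ f * f
          eq = trans (lem σ (bar f) f) (trans (*-congʳ (sgn² d)) (*-identityˡ _))

-- The integral group ring of an abelian group.

module GroupRing {G : Set} {_∙_ : G → G → G} {ε : G} {inv : G → G}
  (isAbelianGroup : IsAbelianGroup _≡_ _∙_ ε inv) where

  private
    module G = IsAbelianGroup isAbelianGroup

  -- Expressions are identified when they act in the same way on integer-valued functions;
  -- in particular commutativity is proved without summing over G.
  infixl 6 _⊞_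
  infixl 7 _⊠_
  infix 8 ⊟_
  data Expr : Set where
    [_]     : G → Expr
    ⓪       : Expr
    ⊟_      : Expr → Expr
    _⊞_ _⊠_ : Expr → Expr → Expr

  act : Expr → (G → ℤ) → G → ℤ
  act [ g ] φ x = φ (g ∙ x)
  act ⓪ φ x = + 0
  act (⊟ f) φ x = ℤ.- act f φ x
  act (f ⊞ g) φ x = act f φ x ℤ.+ act g φ x
  act (f ⊠ g) φ x = act f (act g φ) x

  infix 4 _≈_
  record _≈_ (f g : Expr) : Set where
    constructor mk
    field at : ∀ φ x → act f φ x ≡ act g φ x
  open _≈_ public

  act-cong : ∀ f {φ ψ} → (∀ x → φ x ≡ ψ x) → ∀ x → act f φ x ≡ act f ψ x
  act-cong [ g ] e x = e (g ∙ x)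
  act-cong ⓪ e x = ≡.refl
  act-cong (⊟ f) e x = ≡.cong ℤ.-_ (act-cong f e x)
  act-cong (f ⊞ g) e x = ≡.cong₂ ℤ._+_ (act-cong f e x) (act-cong g e x)
  act-cong (f ⊠ g) e x = act-cong f (act-cong g e) x

  act-+ : ∀ f φ ψ x → act f (λ y → φ y ℤ.+ ψ y) x ≡ act f φ x ℤ.+ act f ψ x
  act-+ [ g ] φ ψ x = ≡.refl
  act-+ ⓪ φ ψ x = ≡.refl
  act-+ (⊟ f) φ ψ x = ≡.trans (≡.cong ℤ.-_ (act-+ f φ ψ x))
    (ℤ.neg-distrib-+ (act f φ x) (act f ψ x))
  act-+ (f ⊞ g) φ ψ x = ≡.trans (≡.cong₂ ℤ._+_ (act-+ f φ ψ x) (act-+ g φ ψ x))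
    (swap (act f φ x) (act f ψ x) (act g φ x) (act g ψ x))
    where
    swap : ∀ a b c d → (a ℤ.+ b) ℤ.+ (c ℤ.+ d) ≡ (a ℤ.+ c) ℤ.+ (b ℤ.+ d)
    swap = solve-∀
  act-+ (f ⊠ g) φ ψ x = ≡.trans (act-cong f (act-+ g φ ψ) x) (act-+ f (act g φ) (act g ψ) x)

  act-scale : ∀ f c φ x → act f (λ y → c ℤ.* φ y) x ≡ c ℤ.* act f φ x
  act-scale [ g ] c φ x = ≡.refl
  act-scale ⓪ c φ x = ≡.sym (ℤ.*-zeroʳ c)
  act-scale (⊟ f) c φ x = ≡.trans (≡.cong ℤ.-_ (act-scale f c φ x)) (ℤ.neg-distribʳ-* c (act f φ x))
  act-scale (f ⊞ g) c φ x = ≡.trans (≡.cong₂ ℤ._+_ (act-scale f c φ x) (act-scale g c φ x))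
    (≡.sym (ℤ.*-distribˡ-+ c (act f φ x) (act g φ x)))
  act-scale (f ⊠ g) c φ x = ≡.trans (act-cong f (act-scale g c φ) x) (act-scale f c (act g φ) x)

  act-neg : ∀ f φ x → act f (λ y → ℤ.- φ y) x ≡ ℤ.- act f φ x
  act-neg f φ x = ≡.trans (act-cong f (λ y → ≡.sym (ℤ.-1*i≡-i (φ y))) x)
    (≡.trans (act-scale f ℤ.-1ℤ φ x) (ℤ.-1*i≡-i (act f φ x)))

  act-zero : ∀ f x → act f (λ _ → + 0) x ≡ + 0
  act-zero f x = act-scale f (+ 0) (λ _ → + 0) x

  act-shift : ∀ f g φ x → act f φ (g ∙ x) ≡ act f (λ y → φ (g ∙ y)) x
  act-shift [ a ] g φ x = ≡.cong φ
    (≡.trans (≡.sym (G.assoc a g x)) (≡.trans (≡.cong (_∙ x) (G.comm a g)) (G.assoc g a x)))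
  act-shift ⓪ g φ x = ≡.refl
  act-shift (⊟ f) g φ x = ≡.cong ℤ.-_ (act-shift f g φ x)
  act-shift (f ⊞ f′) g φ x = ≡.cong₂ ℤ._+_ (act-shift f g φ x) (act-shift f′ g φ x)
  act-shift (f ⊠ f′) g φ x = ≡.trans (act-shift f g (act f′ φ) x) (act-cong f (act-shift f′ g φ) x)

  act-comm : ∀ f g φ x → act f (act g φ) x ≡ act g (act f φ) x
  act-comm [ a ] g φ x = act-shift g a φ x
  act-comm ⓪ g φ x = ≡.sym (act-zero g x)
  act-comm (⊟ f) g φ x = ≡.trans (≡.cong ℤ.-_ (act-comm f g φ x)) (≡.sym (act-neg g (act f φ) x))
  act-comm (f ⊞ f′) g φ x = ≡.trans (≡.cong₂ ℤ._+_ (act-comm f g φ x) (act-comm f′ g φ x))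
    (≡.sym (act-+ g (act f φ) (act f′ φ) x))
  act-comm (f ⊠ f′) g φ x = ≡.trans (act-cong f (act-comm f′ g φ) x) (act-comm f g (act f′ φ) x)

  groupRing : CommutativeRing 0ℓ 0ℓ
  groupRing = record
    { Carrier = Expr ; _≈_ = _≈_ ; _+_ = _⊞_ ; _*_ = _⊠_ ; -_ = ⊟_ ; 0# = ⓪ ; 1# = [ ε ]
    ; isCommutativeRing = record
      { isRing = record
        { +-isAbelianGroup = record
          { isGroup = record
            { isMonoid = record
              { isSemigroup = record
                { isMagma = record
                  { isEquivalence = record
                    { refl = mk λ _ _ → ≡.refl
                    ; sym = λ e → mk λ φ x → ≡.sym (at e φ x)
                    ; trans = λ e e′ → mk λ φ x → ≡.trans (at e φ x) (at e′ φ x) }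
                  ; ∙-cong = λ e e′ → mk λ φ x → ≡.cong₂ ℤ._+_ (at e φ x) (at e′ φ x) }
                ; assoc = λ f g h → mk λ φ x → ℤ.+-assoc (act f φ x) _ _ }
              ; identity = (λ f → mk λ φ x → ℤ.+-identityˡ _) , (λ f → mk λ φ x → ℤ.+-identityʳ _) }
            ; inverse = (λ f → mk λ φ x → ℤ.+-inverseˡ (act f φ x)) ,
              (λ f → mk λ φ x → ℤ.+-inverseʳ (act f φ x))
            ; ⁻¹-cong = λ e → mk λ φ x → ≡.cong ℤ.-_ (at e φ x) }
          ; comm = λ f g → mk λ φ x → ℤ.+-comm (act f φ x) _ }
        ; *-cong = λ {f} {f′} {g} {g′} e e′ → mk λ φ x → ≡.trans (act-cong f (at e′ φ) x)
          (at e (act g′ φ) x)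
        ; *-assoc = λ f g h → mk λ φ x → ≡.refl
        ; *-identity = (λ f → mk λ φ x → ≡.cong (act f φ) (G.identityˡ x))
                     , (λ f → mk λ φ x → act-cong f (λ y → ≡.cong φ (G.identityˡ y)) x)
        ; distrib = (λ f g h → mk λ φ x → act-+ f (act g φ) (act h φ) x) ,
          (λ f g h → mk λ φ x → ≡.refl) }
      ; *-comm = λ f g → mk λ φ x → act-comm f g φ x } }

  open CommutativeRing groupRing using (refl; sym; trans; +-cong; +-congʳ; +-congˡ; *-congˡ; -‿cong; *-identityˡ; *-identityʳ; zeroˡ; +-identityʳ; -‿inverseʳ)
  open Exp (CommutativeRing.commutativeSemiring groupRing) using (_^_; ^-congˡ; ^-distrib-*)
  open Mult (CommutativeRing.semiring groupRing) using () renaming (_×_ to _·_)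
  open IntegerMorphism.Solver groupRing using (solve; _:=_; _:+_; _:*_; :-_)

  T : G → Expr
  T g = [ g ] ⊞ ⊟ [ ε ]

  [∙] : ∀ g h → [ g ] ⊠ [ h ] ≈ [ g ∙ h ]
  [∙] g h = mk λ φ x → ≡.cong φ (≡.trans (≡.sym (G.assoc h g x)) (≡.cong (_∙ x) (G.comm h g)))

  bar : Expr → Expr
  bar [ g ] = [ inv g ]
  bar ⓪ = ⓪
  bar (⊟ f) = ⊟ bar f
  bar (f ⊞ g) = bar f ⊞ bar g
  bar (f ⊠ g) = bar f ⊠ bar g

  abelianGroup : AbelianGroup 0ℓ 0ℓ
  abelianGroup = record { isAbelianGroup = isAbelianGroup }

  open import Algebra.Properties.AbelianGroup abelianGroup
    using (ε⁻¹≈ε; ⁻¹-∙-comm; ⁻¹-involutive)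

  -- `bar` is defined on syntax; as an operator it is conjugation by the reflection `inv`. This is
  -- what makes it respect `_≈_`.
  act-bar : ∀ f φ x → act (bar f) φ x ≡ act f (λ y → φ (inv y)) (inv x)
  act-bar [ g ] φ x = ≡.cong φ
    (≡.sym (≡.trans (≡.sym (⁻¹-∙-comm g (inv x))) (≡.cong (inv g ∙_) (⁻¹-involutive x))))
  act-bar ⓪ φ x = ≡.refl
  act-bar (⊟ f) φ x = ≡.cong ℤ.-_ (act-bar f φ x)
  act-bar (f ⊞ g) φ x = ≡.cong₂ ℤ._+_ (act-bar f φ x) (act-bar g φ x)
  act-bar (f ⊠ g) φ x = ≡.trans (act-bar f (act (bar g) φ) x) (act-cong f
    (λ y → ≡.trans (act-bar g φ (inv y)) (≡.cong (act g (λ z → φ (inv z))) (⁻¹-involutive y)))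
      (inv x))

  bar-cong : ∀ {f g} → f ≈ g → bar f ≈ bar g
  bar-cong {f} {g} e = mk λ φ x → ≡.trans (act-bar f φ x)
    (≡.trans (at e _ (inv x)) (≡.sym (act-bar g φ x)))

  bar-1 : bar [ ε ] ≈ [ ε ]
  bar-1 = mk λ φ x → ≡.cong (λ y → φ (y ∙ x)) ε⁻¹≈ε

  bar-· : ∀ n → bar (n · [ ε ]) ≈ n · [ ε ]
  bar-· zero = refl
  bar-· (suc n) = +-cong bar-1 (bar-· n)

  bar-T : ∀ g → bar (T g) ≈ ⊟ T g ⊞ ⊟ (T (inv g) ⊠ T g)
  bar-T g = trans (+-congˡ (-‿cong bar-1)) (trans (lem [ inv g ] [ g ] [ ε ])
    (+-cong refl (-‿cong (sym (trans (expand [ inv g ] [ g ] [ ε ])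
      (+-cong (+-cong (trans ([∙] (inv g) g) (mk λ φ x → ≡.cong (λ y → φ (y ∙ x)) (G.inverseˡ g)))
      (-‿cong (*-identityʳ _))) (+-cong (-‿cong (*-identityˡ _)) (*-identityˡ _))))))))
    where
    expand : ∀ a b o → (a ⊞ ⊟ o) ⊠ (b ⊞ ⊟ o) ≈ (a ⊠ b ⊞ ⊟ (a ⊠ o)) ⊞ (⊟ (o ⊠ b) ⊞ o ⊠ o)
    expand = solve 3 (λ a b o → (a :+ :- o) :* (b :+ :- o) := (a :* b :+ :- (a :* o)) :+
      (:- (o :* b) :+ o :* o)) refl
    lem : ∀ a b o → a ⊞ ⊟ o ≈ ⊟ (b ⊞ ⊟ o) ⊞ ⊟ ((o ⊞ ⊟ a) ⊞ (⊟ b ⊞ o))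
    lem = solve 3 (λ a b o → a :+ :- o := :- (b :+ :- o) :+ :- ((o :+ :- a) :+ (:- b :+ o))) refl

  infixr 8 _⋆_
  _⋆_ : ℕ → G → G
  zero ⋆ g = ε
  suc n ⋆ g = g ∙ (n ⋆ g)

  [⋆] : ∀ n g → [ g ] ^ n ≈ [ n ⋆ g ]
  [⋆] zero g = refl
  [⋆] (suc n) g = trans (*-congˡ ([⋆] n g)) ([∙] g (n ⋆ g))

  module ModP (m : ℕ) (p-prime : Prime (suc (suc m))) (p-torsion : ∀ g → suc (suc m) ⋆ g ≡ ε) where

    private
      p : ℕ
      p = suc (suc m)

    u : Expr
    u = ⊟ (p · [ ε ])

    [⋆p] : ∀ g → [ g ] ^ p ≈ [ ε ]
    [⋆p] g = trans ([⋆] p g) (mk λ φ x → ≡.cong (λ y → φ (y ∙ x)) (p-torsion g))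

    T^p-expansion : ∀ g → ∃ λ v → T g ^ p ≈ u ⊠ T g ⊞ u ⊠ (T g ⊠ T g ⊠ v)
    T^p-expansion g = PrimeBinomial.unipotent-^p groupRing m p-prime [ g ] ([⋆p] g)

    open Filtration.Generated groupRing m p-prime G T (λ g → proj₁ (T^p-expansion g)) (λ g → proj₂ (T^p-expansion g)) public

    private
      1=suc-p*0 : suc (p ℕ.* 0) ≡ 1
      1=suc-p*0 = ≡.cong suc (ℕ.*-zeroʳ p)

    freshman₁ : ∀ f g → Fil 1 ((f ⊞ g) ^ p ⊞ ⊟ (f ^ p ⊞ g ^ p))
    freshman₁ f g = cast 1=suc-p*0 (Fil-freshman (all f) (all g))

    -- Fermat's little theorem: modulo weight 1 every group element becomes 1 and `p` becomes 0.
    -- Induction on the expression avoids an augmentation map.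
    base : ∀ f → Fil 1 (f ^ p ⊞ ⊟ f)
    base [ g ] = ext (+-congʳ (sym ([⋆p] g)))
      (ext (solve 2 (λ a o → :- (a :+ :- o) := o :+ :- a) refl [ g ] [ ε ]) (Fil-neg (Fil-T g)))
    base ⓪ = ext (sym (trans (+-congʳ (zeroˡ _)) (-‿inverseʳ ⓪))) (Fil-0 1)
    -- The sign is obtained by comparing the p-th power of `f ⊞ ⊟ f`, which is zero, with
    -- `freshman₁`; no parity of `p` enters.
    base (⊟ f) = ext (trans (lem (f ^ p) ((⊟ f) ^ p) f ((f ⊞ ⊟ f) ^ p) )
        (trans (+-congˡ {(⊟ f) ^ p ⊞ ⊟ (⊟ f)}
          (trans (-‿cong (trans (^-congˡ p (-‿inverseʳ f)) (zeroˡ (⓪ ^ suc m))))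
          (mk λ _ _ → ≡.refl))) (+-identityʳ _)))
      (Fil-neg (plus (base f) (freshman₁ f (⊟ f))))
      where
      lem : ∀ a b f z → ⊟ ((a ⊞ ⊟ f) ⊞ (z ⊞ ⊟ (a ⊞ b))) ≈ (b ⊞ ⊟ (⊟ f)) ⊞ ⊟ z
      lem = solve 4 (λ a b f z → :- ((a :+ :- f) :+ (z :+ :- (a :+ b))) := (b :+ :- (:- f)) :+ :- z)
        refl
    base (f ⊞ g) = ext (lem (f ^ p) (g ^ p) f g ((f ⊞ g) ^ p))
      (plus (plus (base f) (base g)) (freshman₁ f g))
      where
      lem : ∀ a b f g z → ((a ⊞ ⊟ f) ⊞ (b ⊞ ⊟ g)) ⊞ (z ⊞ ⊟ (a ⊞ b)) ≈ z ⊞ ⊟ (f ⊞ g)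
      lem = solve 5 (λ a b f g z → ((a :+ :- f) :+ (b :+ :- g)) :+ (z :+ :- (a :+ b)) := z :+ :-
        (f :+ g)) refl
    base (f ⊠ g) = ext (trans (lem (f ^ p) (g ^ p) f g) (+-congʳ (sym (^-distrib-* f g p))))
      (plus (Fil-scale (g ^ p) (base f)) (Fil-scale f (base g)))
      where
      lem : ∀ a b f g → b ⊠ (a ⊞ ⊟ f) ⊞ f ⊠ (b ⊞ ⊟ g) ≈ a ⊠ b ⊞ ⊟ (f ⊠ g)
      lem = solve 4 (λ a b f g → b :* (a :+ :- f) :+ f :* (b :+ :- g) := a :* b :+ :- (f :* g)) refl

    bar-base : ∀ f → Fil 1 (bar f ⊞ ⊟ f)
    bar-base [ g ] = ext (solve 3 (λ a b o → (a :+ :- o) :+ :- (b :+ :- o) := a :+ :- b) refl [ inv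
      g ] [ g ] [ ε ])
      (plus (Fil-T (inv g)) (Fil-neg (Fil-T g)))
    bar-base ⓪ = ext (sym (-‿inverseʳ ⓪)) (Fil-0 1)
    bar-base (⊟ f) = ext (solve 2 (λ a b → :- (a :+ :- b) := :- a :+ :- (:- b)) refl (bar f) f)
      (Fil-neg (bar-base f))
    bar-base (f ⊞ g) = ext (solve 4
      (λ a b c d → (a :+ :- b) :+ (c :+ :- d) := (a :+ c) :+ :- (b :+ d)) refl (bar f) f (bar g) g)
      (plus (bar-base f) (bar-base g))
    bar-base (f ⊠ g) = ext (solve 4
      (λ a b c d → c :* (a :+ :- b) :+ b :* (c :+ :- d) := a :* c :+ :- (b :* d)) refl (bar f) f
      (bar g) g)
      (plus (Fil-scale (bar g) (bar-base f)) (Fil-scale f (bar-base g)))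

    open Saturation base public
      hiding (module Involution)

    module Odd (half : ℕ) (h-even : suc m ≡ half ℕ.+ half) =
      Saturation.Involution base bar bar-cong (λ _ _ → refl) (λ _ _ → refl) (-‿cong (bar-· p))
        (λ g → inv g , bar-T g) bar-base half h-even

-- Integer-valued polynomial functions and their pairing with the filtration.

∣0 : ∀ k → k ∣ + 0
∣0 k = divides (+ 0) ≡.refl

∣-subst : ∀ {k x y} → x ≡ y → k ∣ x → k ∣ y
∣-subst ≡.refl d = d

^-∣-^ : ∀ x {m n} → m ≤ n → x ℤ.^ m ∣ x ℤ.^ n
^-∣-^ x {m} {n} m≤n = divides (x ℤ.^ (n ∸ m))
  (≡.trans (≡.cong (x ℤ.^_) (≡.sym (ℕ.m∸n+n≡m m≤n))) (ℤ.^-distribˡ-+-* x (n ∸ m) m))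

*-∣-* : ∀ {a b x y} → a ∣ x → b ∣ y → a ℤ.* b ∣ x ℤ.* y
*-∣-* {a} {b} {x} {y} d e = ∣-trans (*-monoˡ-∣ b d) (*-monoʳ-∣ x e)

module Polynomials {G : Set} {_∙_ : G → G → G} {ε : G} {inv : G → G}
  (isAbelianGroup : IsAbelianGroup _≡_ _∙_ ε inv)
  (m : ℕ) (p-prime : Prime (suc (suc m)))
    (p-torsion : ∀ g → GroupRing._⋆_ isAbelianGroup (suc (suc m)) g ≡ ε) where

  private
    h p : ℕ
    h = suc m
    p = suc h

  open GroupRing isAbelianGroup
  open ModP m p-prime p-torsion
  open CommutativeRing groupRing using (refl; sym; trans; +-cong; +-congʳ; *-congʳ; *-congˡ; *-identityˡ; *-identityʳ)
  open Exp (CommutativeRing.commutativeSemiring groupRing) using (_^_; ^-homo-*; ^-congʳ)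
  open Mult (CommutativeRing.semiring groupRing) using () renaming (_×_ to _·_)
  open IntegerMorphism.Solver groupRing using (solve; _:=_; _:+_; _:*_; :-_)
  private module G = IsAbelianGroup isAbelianGroup

  D : G → (G → ℤ) → G → ℤ
  D g φ x = φ (g ∙ x) ℤ.- φ x

  act-T : ∀ g φ x → act (T g) φ x ≡ D g φ x
  act-T g φ x = ≡.cong (λ y → φ (g ∙ x) ℤ.- φ y) (G.identityˡ x)

  Δ : List G → (G → ℤ) → G → ℤ
  Δ [] φ = φ
  Δ (g ∷ gs) φ = Δ gs (D g φ)

  Δ-cong : ∀ gs {φ ψ} → (∀ x → φ x ≡ ψ x) → ∀ x → Δ gs φ x ≡ Δ gs ψ x
  Δ-cong [] e = e
  Δ-cong (g ∷ gs) e = Δ-cong gs (λ x → ≡.cong₂ ℤ._-_ (e (g ∙ x)) (e x))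

  Δ-+ : ∀ gs φ ψ x → Δ gs (λ y → φ y ℤ.+ ψ y) x ≡ Δ gs φ x ℤ.+ Δ gs ψ x
  Δ-+ [] φ ψ x = ≡.refl
  Δ-+ (g ∷ gs) φ ψ x = ≡.trans (Δ-cong gs (λ y → swap (φ (g ∙ y)) (ψ (g ∙ y)) (φ y) (ψ y)) x)
    (Δ-+ gs (D g φ) (D g ψ) x)
    where
    swap : ∀ a b c d → (a ℤ.+ b) ℤ.- (c ℤ.+ d) ≡ (a ℤ.- c) ℤ.+ (b ℤ.- d)
    swap = solve-∀

  Δ-scale : ∀ gs c φ x → Δ gs (λ y → c ℤ.* φ y) x ≡ c ℤ.* Δ gs φ x
  Δ-scale [] c φ x = ≡.refl
  Δ-scale (g ∷ gs) c φ x = ≡.trans (Δ-cong gs (λ y → factor c (φ (g ∙ y)) (φ y)) x)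
    (Δ-scale gs c (D g φ) x)
    where
    factor : ∀ c a b → c ℤ.* a ℤ.- c ℤ.* b ≡ c ℤ.* (a ℤ.- b)
    factor = solve-∀

  Δ-const : ∀ g gs c x → Δ (g ∷ gs) (λ _ → c) x ≡ + 0
  Δ-const g gs c x = ≡.trans (Δ-cong gs {ψ = λ _ → + 0 ℤ.* + 0} (λ _ → ℤ.+-inverseʳ c) x)
    (Δ-scale gs (+ 0) (λ _ → + 0) x)

  Δ-shift : ∀ gs g φ x → Δ gs (λ y → φ (g ∙ y)) x ≡ Δ gs φ (g ∙ x)
  Δ-shift [] g φ x = ≡.refl
  Δ-shift (a ∷ gs) g φ x = ≡.trans
    (Δ-cong gs (λ y → ≡.cong (λ z → φ z ℤ.- φ (g ∙ y))
      (≡.trans (≡.sym (G.assoc g a y)) (≡.trans (≡.cong (_∙ y) (G.comm g a)) (G.assoc a g y)))) x)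
    (Δ-shift gs g (D a φ) x)

  -- φ behaves like an r-fold difference of an integer polynomial function of degree at most e,
  -- where a factor p lowers the degree by p - 1.
  Ψ : ℕ → ℕ → (G → ℤ) → Set
  Ψ r e φ = ∀ gs x a → e ℕ.+ a ℕ.* h < r ℕ.+ length gs → (+ p) ℤ.^ suc a ∣ Δ gs φ x

  Ψ-D : ∀ g {r e φ} → Ψ r e φ → Ψ (suc r) e (D g φ)
  Ψ-D g {r} {e} P gs x a lt = P (g ∷ gs) x a
    (≡.subst (e ℕ.+ a ℕ.* h <_) (≡.sym (ℕ.+-suc r (length gs))) lt)

  Ψ-shift : ∀ g {r e φ} → Ψ r e φ → Ψ r e (λ x → φ (g ∙ x))
  Ψ-shift g {φ = φ} P gs x a lt = ∣-subst (≡.sym (Δ-shift gs g φ x)) (P gs (g ∙ x) a lt)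

  Ψ-const : ∀ c → Ψ 0 0 (λ _ → c)
  Ψ-const c [] x a ()
  Ψ-const c (g ∷ gs) x a lt = ∣-subst (≡.sym (Δ-const g gs c x)) (∣0 _)

  -- The hypotheses say that the p-adic valuation of `X` is at least `(r - e) / h` rounded up, and
  -- likewise for `Y`. The sum of two numbers rounded up is at least their rounded sum; if one bound
  -- is not positive, the other factor alone suffices.
  valuation-* : ∀ {r e r′ e′ X Y} →
    (∀ a → e ℕ.+ a ℕ.* h < r → (+ p) ℤ.^ suc a ∣ X) →
      (∀ a → e′ ℕ.+ a ℕ.* h < r′ → (+ p) ℤ.^ suc a ∣ Y) →
    ∀ a → (e ℕ.+ e′) ℕ.+ a ℕ.* h < r ℕ.+ r′ → (+ p) ℤ.^ suc a ∣ X ℤ.* Y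
  valuation-* {r} {e} {r′} {e′} {X} {Y} H H′ a lt with r ℕ.≤? e | r′ ℕ.≤? e′
  ... | yes r≤e | _ = ∣n⇒∣m*n X
    (H′ a (ℕ.+-cancelˡ-< e _ _
    (ℕ.<-≤-trans (≡.subst (_< r ℕ.+ r′) (ℕ.+-assoc e e′ _) lt) (ℕ.+-monoˡ-≤ r′ r≤e))))
  ... | no _ | yes r′≤e′ = ∣m⇒∣m*n Y
    (H a (ℕ.+-cancelˡ-< e′ _ _
    (ℕ.<-≤-trans (≡.subst₂ _<_ (eq e e′ (a ℕ.* h)) (ℕ.+-comm r r′) lt) (ℕ.+-monoˡ-≤ r r′≤e′))))
    where
    eq : ∀ e e′ x → e ℕ.+ e′ ℕ.+ x ≡ e′ ℕ.+ (e ℕ.+ x)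
    eq = ℕS.solve-∀
  ... | no r≰e | no r′≰e′ = ∣-trans (^-∣-^ (+ p) a<)
    (∣-subst′ (*-∣-* (H q (bound e r (ℕ.≰⇒> r≰e))) (H′ q′ (bound e′ r′ (ℕ.≰⇒> r′≰e′)))))
    where
    y = r ∸ suc e
    y′ = r′ ∸ suc e′
    -- The largest `a` with `e + a h < r`, so that `suc q` is the valuation guaranteed for `X`.
    q = y ℕ./ h
    q′ = y′ ℕ./ h
    bound : ∀ e r → e < r → e ℕ.+ (r ∸ suc e) ℕ./ h ℕ.* h < r
    bound e r e<r = ℕ.≤-trans (s≤s (ℕ.+-monoʳ-≤ e (ℕ.m/n*n≤m (r ∸ suc e) h)))
      (ℕ.≤-reflexive (ℕ.m+[n∸m]≡n e<r))
    above : ∀ e r → e < r → r ≤ e ℕ.+ suc ((r ∸ suc e) ℕ./ h) ℕ.* h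
    above e r e<r = begin
      r                                        ≡⟨ ℕ.m+[n∸m]≡n e<r ⟨
      suc e ℕ.+ z                              ≡⟨ ℕ.+-suc e z ⟨
      e ℕ.+ suc z
        ≤⟨ ℕ.+-monoʳ-≤ e (s≤s (ℕ.≤-reflexive (ℕ.m≡m%n+[m/n]*n z h))) ⟩
      e ℕ.+ (suc (z ℕ.% h) ℕ.+ z ℕ./ h ℕ.* h)
        ≤⟨ ℕ.+-monoʳ-≤ e (ℕ.+-monoˡ-≤ (z ℕ./ h ℕ.* h) (ℕ.m%n<n z h)) ⟩
      e ℕ.+ suc (z ℕ./ h) ℕ.* h                ∎
      where
      open ℕ.≤-Reasoning
      z = r ∸ suc e
    a< : suc a ≤ suc q ℕ.+ suc q′
    a< = ℕ.*-cancelʳ-< _ a (suc q ℕ.+ suc q′) (ℕ.+-cancelˡ-< (e ℕ.+ e′) _ _ (ℕ.<-≤-trans lt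
      (ℕ.≤-trans (ℕ.+-mono-≤ (above e r (ℕ.≰⇒> r≰e)) (above e′ r′ (ℕ.≰⇒> r′≰e′)))
        (ℕ.≤-reflexive (eq e e′ (suc q) (suc q′) h)))))
      where
      eq : ∀ e e′ q q′ h → e ℕ.+ q ℕ.* h ℕ.+ (e′ ℕ.+ q′ ℕ.* h) ≡ e ℕ.+ e′ ℕ.+ (q ℕ.+ q′) ℕ.* h
      eq = ℕS.solve-∀
    ∣-subst′ : (+ p) ℤ.^ suc q ℤ.* (+ p) ℤ.^ suc q′ ∣ X ℤ.* Y → (+ p) ℤ.^ (suc q ℕ.+ suc q′) ∣ X ℤ.*
      Y
    ∣-subst′ = ≡.subst (_∣ X ℤ.* Y) (≡.sym (ℤ.^-distribˡ-+-* (+ p) (suc q) (suc q′)))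

  -- Induction on the list by the Leibniz rule of differences, one factor being shifted. The index
  -- `r` exists for this induction: it counts the differences that a factor has already absorbed.
  Ψ-* : ∀ {r e r′ e′ φ ψ} → Ψ r e φ → Ψ r′ e′ ψ → Ψ (r ℕ.+ r′) (e ℕ.+ e′) (λ x → φ x ℤ.* ψ x)
  Ψ-* {r} {e} {r′} {e′} {φ} {ψ} P Q [] x a lt = valuation-* {r} {e} {r′} {e′}
    (λ a l → P [] x a (≡.subst (e ℕ.+ a ℕ.* h <_) (≡.sym (ℕ.+-identityʳ r)) l))
    (λ a l → Q [] x a (≡.subst (e′ ℕ.+ a ℕ.* h <_) (≡.sym (ℕ.+-identityʳ r′)) l))
    a (≡.subst (e ℕ.+ e′ ℕ.+ a ℕ.* h <_) (ℕ.+-identityʳ (r ℕ.+ r′)) lt)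
  Ψ-* {r} {e} {r′} {e′} {φ} {ψ} P Q (g ∷ gs) x a lt = ∣-subst (≡.sym leibniz)
    (∣m∣n⇒∣m+n
      (Ψ-* {suc r} {e} {r′} {e′} (Ψ-D g {r} {e} P) (Ψ-shift g {r′} {e′} Q) gs x a
        (≡.subst (e ℕ.+ e′ ℕ.+ a ℕ.* h <_) (ℕ.+-suc (r ℕ.+ r′) (length gs)) lt))
      (Ψ-* {r} {e} {suc r′} {e′} P (Ψ-D g {r′} {e′} Q) gs x a
        (≡.subst (e ℕ.+ e′ ℕ.+ a ℕ.* h <_) (eq r r′ (length gs)) lt)))
    where
    eq : ∀ r r′ l → r ℕ.+ r′ ℕ.+ suc l ≡ r ℕ.+ suc r′ ℕ.+ l
    eq = ℕS.solve-∀
    rule : ∀ a b c d → a ℤ.* b ℤ.- c ℤ.* d ≡ (a ℤ.- c) ℤ.* b ℤ.+ c ℤ.* (b ℤ.- d)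
    rule = solve-∀
    leibniz : Δ (g ∷ gs) (λ y → φ y ℤ.* ψ y) x ≡
      Δ gs (λ y → D g φ y ℤ.* ψ (g ∙ y)) x ℤ.+ Δ gs (λ y → φ y ℤ.* D g ψ y) x
    leibniz = ≡.trans (Δ-cong gs (λ y → rule (φ (g ∙ y)) (ψ (g ∙ y)) (φ y) (ψ y)) x)
      (Δ-+ gs (λ y → D g φ y ℤ.* ψ (g ∙ y)) (λ y → φ y ℤ.* D g ψ y) x)

  act-∣ : ∀ f {k φ} → (∀ x → k ∣ φ x) → ∀ x → k ∣ act f φ x
  act-∣ [ g ] d x = d (g ∙ x)
  act-∣ ⓪ d x = ∣0 _
  act-∣ (⊟ f) d x = ∣m⇒∣-m (act-∣ f d x)
  act-∣ (f ⊞ g) d x = ∣m∣n⇒∣m+n (act-∣ f d x) (act-∣ g d x)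
  act-∣ (f ⊠ g) d x = act-∣ f (act-∣ g d) x

  act-· : ∀ n φ x → act (n · [ ε ]) φ x ≡ + n ℤ.* φ x
  act-· zero φ x = ≡.refl
  act-· (suc n) φ x = ≡.trans (≡.cong₂ ℤ._+_ (≡.cong φ (G.identityˡ x)) (act-· n φ x))
    (≡.sym (ℤ.suc-* (+ n) (φ x)))

  act-u : ∀ φ x → act u φ x ≡ (ℤ.- + p) ℤ.* φ x
  act-u φ x = ≡.trans (≡.cong ℤ.-_ (act-· p φ x)) (ℤ.neg-distribˡ-* (+ p) (φ x))

  act-u^ : ∀ k φ x → act (u ^ k) φ x ≡ (ℤ.- + p) ℤ.^ k ℤ.* φ x
  act-u^ zero φ x = ≡.trans (≡.cong φ (G.identityˡ x)) (≡.sym (ℤ.*-identityˡ _))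
  act-u^ (suc k) φ x = ≡.trans (act-u (act (u ^ k) φ) x)
    (≡.trans (≡.cong ((ℤ.- + p) ℤ.*_) (act-u^ k φ x))
      (≡.sym (ℤ.*-assoc (ℤ.- + p) ((ℤ.- + p) ℤ.^ k) (φ x))))

  -- Weight pairs with degree. A factor `T g` is moved across the action and becomes one more
  -- difference of `φ`; a factor `u` yields an explicit `p` in exchange for `h` units of weight.
  Fil-Ψ : ∀ {d f} → Fil d f → ∀ {r e φ} → Ψ r e φ → ∀ x a → e ℕ.+ a ℕ.* h < r ℕ.+ d → (+ p) ℤ.^ suc
    a ∣ act f φ x
  Fil-Ψ (all f) P x a lt = act-∣ f (λ y → P [] y a lt) x
  Fil-Ψ (plus F F′) {r} {e} P x a lt = ∣m∣n⇒∣m+n (Fil-Ψ F {r} {e} P x a lt)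
    (Fil-Ψ F′ {r} {e} P x a lt)
  Fil-Ψ (gen g {d} {f} F) {r} {e} {φ} P x a lt = ∣-subst
    (≡.trans (act-cong f (λ y → ≡.sym (act-T g φ y)) x) (act-comm f (T g) φ x))
    (Fil-Ψ F {suc r} {e} (Ψ-D g {r} {e} P) x a (≡.subst (e ℕ.+ a ℕ.* h <_) (ℕ.+-suc r d) lt))
  -- Only one factor `p` is asked for, and `u` supplies it.
  Fil-Ψ (unif {d} {f} F) {φ = φ} P x zero lt = ∣-subst (≡.sym (act-u (act f φ) x))
    (∣m⇒∣m*n (act f φ x) (∣m⇒∣-m
      (divides (+ 1) (≡.trans (≡.sym (ℤ.*-identityʳ (+ p))) (≡.sym (ℤ.*-identityˡ _))))))
  Fil-Ψ (unif {d} {f} F) {r} {e} {φ} P x (suc a) lt = ∣-subst (≡.sym (act-u (act f φ) x))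
    (*-∣-* {+ p} {(+ p) ℤ.^ suc a} (∣m⇒∣-m ∣-refl)
      (Fil-Ψ F {r} {e} P x a (ℕ.+-cancelˡ-< h _ _ (≡.subst₂ _<_ (eq h e (a ℕ.* h)) (eq h r d) lt))))
    where
    eq : ∀ h e x → e ℕ.+ (h ℕ.+ x) ≡ h ℕ.+ (e ℕ.+ x)
    eq = ℕS.solve-∀
  Fil-Ψ (ext f≈g F) {r} {e} {φ} P x a lt = ∣-subst (at f≈g φ x) (Fil-Ψ F {r} {e} P x a lt)
  Fil-Ψ (weak d≤e F) {r} {e} P x a lt = Fil-Ψ F {r} {e} P x a (ℕ.<-≤-trans lt (ℕ.+-monoʳ-≤ r d≤e))

  cancel-p^ : ∀ k y → (+ p) ℤ.^ suc k ∣ (ℤ.- + p) ℤ.^ k ℤ.* y → + p ∣ y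
  cancel-p^ zero y d = ≡.subst₂ _∣_ (ℤ.*-identityʳ (+ p)) (ℤ.*-identityˡ y) d
  cancel-p^ (suc k) y d = cancel-p^ k y (*-cancelˡ-∣ (+ p) (∣-subst flip (∣m⇒∣-m d)))
    where
    P = (ℤ.- + p) ℤ.^ k
    lem : ∀ q P y → ℤ.- (ℤ.- q ℤ.* P ℤ.* y) ≡ q ℤ.* (P ℤ.* y)
    lem = solve-∀
    flip : ℤ.- ((ℤ.- + p) ℤ.* P ℤ.* y) ≡ + p ℤ.* (P ℤ.* y)
    flip = lem (+ p) P y

  -- Saturation bounds only `u ^ k * f`. Control of `φ` modulo `p ^ (k + 1)` leaves one factor `p`
  -- after `p ^ k` is cancelled.
  Sat-Ψ : ∀ {d f e φ} → Sat d f → Ψ 0 e φ → e < d → ∀ x → + p ∣ act f φ x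
  Sat-Ψ {d} {f} {e} {φ} (k , F) P e<d x = cancel-p^ k (act f φ x)
    (∣-subst (act-u^ k (act f φ) x) (Fil-Ψ F {0} {e} P x k (ℕ.+-monoˡ-< (k ℕ.* h) e<d)))

  module Coordinate (c : G → ℕ) (c<p : ∀ x → c x < p)
    (c-∙ : ∀ g x → c (g ∙ x) ≡ (c g ℕ.+ c x) ℕ.% p) (b : G) (c-b : c b ≡ 1) where

    Factors : (G → ℤ) → Set
    Factors φ = ∀ x y → c x ≡ c y → φ x ≡ φ y

    Factors-D : ∀ g {φ} → Factors φ → Factors (D g φ)
    Factors-D g H x y e = ≡.cong₂ ℤ._-_
      (H (g ∙ x) (g ∙ y) (≡.trans (c-∙ g x)
        (≡.trans (≡.cong (λ z → (c g ℕ.+ z) ℕ.% p) e) (≡.sym (c-∙ g y))))) (H x y e)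

    c-⋆ : ∀ n x → c ((n ⋆ b) ∙ x) ≡ (n ℕ.+ c x) ℕ.% p
    c-⋆ zero x = ≡.trans (≡.cong c (G.identityˡ x)) (≡.sym (ℕ.m<n⇒m%n≡m (c<p x)))
    c-⋆ (suc n) x = begin
      c ((b ∙ (n ⋆ b)) ∙ x)                    ≡⟨ ≡.cong c (G.assoc b (n ⋆ b) x) ⟩
      c (b ∙ ((n ⋆ b) ∙ x))                    ≡⟨ c-∙ b ((n ⋆ b) ∙ x) ⟩
      (c b ℕ.+ c ((n ⋆ b) ∙ x)) ℕ.% p          ≡⟨ ≡.cong₂ (λ y z → (y ℕ.+ z) ℕ.% p) c-b (c-⋆ n x) ⟩
      (1 ℕ.+ (n ℕ.+ c x) ℕ.% p) ℕ.% p          ≡⟨ ℕ.%-distribˡ-+ 1 ((n ℕ.+ c x) ℕ.% p) p ⟩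
      (1 ℕ.% p ℕ.+ (n ℕ.+ c x) ℕ.% p ℕ.% p) ℕ.% p
        ≡⟨ ≡.cong (λ z → (1 ℕ.% p ℕ.+ z) ℕ.% p) (ℕ.m%n%n≡m%n (n ℕ.+ c x) p) ⟩
      (1 ℕ.% p ℕ.+ (n ℕ.+ c x) ℕ.% p) ℕ.% p    ≡⟨ ℕ.%-distribˡ-+ 1 (n ℕ.+ c x) p ⟨
      (suc n ℕ.+ c x) ℕ.% p                    ∎
      where open ≡.≡-Reasoning

    geometric : ℕ → Expr
    geometric zero = ⓪
    geometric (suc n) = [ ε ] ⊞ [ b ] ⊠ geometric n

    T-⋆ : ∀ n → T (n ⋆ b) ≈ T b ⊠ geometric n
    T-⋆ zero = trans (CommutativeRing.-‿inverseʳ groupRing [ ε ])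
      (sym (CommutativeRing.zeroʳ groupRing (T b)))
    T-⋆ (suc n) = trans (+-congʳ (sym ([∙] b (n ⋆ b)))) (trans (lem [ b ] [ n ⋆ b ] [ ε ])
      (trans (+-cong (sym (*-identityʳ (T b)))
        (trans (+-cong (*-congˡ {[ b ]} (T-⋆ n)) unit) (CommutativeRing.+-identityʳ groupRing _)))
        (lem₂ (T b) [ ε ] [ b ] (geometric n))))
      where
      lem : ∀ a x o → a ⊠ x ⊞ ⊟ o ≈ (a ⊞ ⊟ o) ⊞ (a ⊠ (x ⊞ ⊟ o) ⊞ (a ⊠ o ⊞ ⊟ a))
      lem = solve 3 (λ a x o → a :* x :+ :- o := (a :+ :- o) :+
        (a :* (x :+ :- o) :+ (a :* o :+ :- a))) refl
      unit : [ b ] ⊠ [ ε ] ⊞ ⊟ [ b ] ≈ ⓪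
      unit = trans (+-congʳ (*-identityʳ [ b ])) (CommutativeRing.-‿inverseʳ groupRing [ b ])
      lem₂ : ∀ t o b g → t ⊠ o ⊞ b ⊠ (t ⊠ g) ≈ t ⊠ (o ⊞ b ⊠ g)
      lem₂ = solve 4 (λ t o b g → t :* o :+ b :* (t :* g) := t :* (o :+ b :* g)) refl

    -- For a function of `c` alone, translation by `g` equals translation by `c g` copies of `b`.
    -- All differences thus become multiples of the single operator `T b`, so that its powers can be
    -- reduced by `T^[1+kh]`.
    D-factors : ∀ g {φ} → Factors φ → ∀ x → D g φ x ≡ act (T b ⊠ geometric (c g)) φ x
    D-factors g {φ} H x = ≡.trans
      (≡.cong (ℤ._- φ x) (H _ _ (≡.trans (c-∙ g x) (≡.sym (c-⋆ (c g) x)))))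
      (≡.trans (≡.sym (act-T (c g ⋆ b) φ x)) (at (T-⋆ (c g)) φ x))

    Δ-factors : ∀ gs → ∃ λ U → ∀ {φ} → Factors φ → ∀ x → Δ gs φ x ≡ act (T b ^ length gs ⊠ U) φ x
    Δ-factors [] = [ ε ] , λ {φ} H x → ≡.trans (≡.cong φ (≡.sym (G.identityˡ x)))
      (≡.sym (at (*-identityˡ [ ε ]) φ x))
    Δ-factors (g ∷ gs) with Δ-factors gs
    ... | U , H = geometric (c g) ⊠ U , λ {φ} F x → ≡.trans (H (Factors-D g F) x)
      (≡.trans (act-cong (T b ^ length gs ⊠ U) (D-factors g F) x)
        (at (lem (T b ^ length gs) U (T b) (geometric (c g))) φ x))
      where
      lem : ∀ t U T g → (t ⊠ U) ⊠ (T ⊠ g) ≈ (T ⊠ t) ⊠ (g ⊠ U)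
      lem = solve 4 (λ t U T g → (t :* U) :* (T :* g) := (T :* t) :* (g :* U)) refl

    Δ-∣ : ∀ gs k → suc (k ℕ.* h) ≤ length gs → ∀ {φ} → Factors φ → ∀ x → (+ p) ℤ.^ k ∣ Δ gs φ x
    Δ-∣ gs k le {φ} F x = ∣-subst
      (≡.sym (≡.trans (H F x) (≡.trans (at eq φ x) (act-u^ k (act (w ⊠ T b ⊠ T b ^ l ⊠ U) φ) x))))
        (∣m⇒∣m*n _ (p^∣-p^ k))
      where
      U = proj₁ (Δ-factors gs)
      H = proj₂ (Δ-factors gs)
      w = proj₁ (T^[1+kh] b k)
      e = proj₂ (T^[1+kh] b k)
      l = length gs ∸ suc (k ℕ.* h)
      lem : ∀ z w T t U → z ⊠ w ⊠ T ⊠ t ⊠ U ≈ z ⊠ (w ⊠ T ⊠ t ⊠ U)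
      lem = solve 5 (λ z w T t U → z :* w :* T :* t :* U := z :* (w :* T :* t :* U)) refl
      eq : T b ^ length gs ⊠ U ≈ u ^ k ⊠ (w ⊠ T b ⊠ T b ^ l ⊠ U)
      eq = trans (*-congʳ {U} (trans (^-congʳ (T b) (≡.sym (ℕ.m+[n∸m]≡n le)))
        (trans (^-homo-* (T b) (suc (k ℕ.* h)) l) (*-congʳ {T b ^ l} e))))
          (lem (u ^ k) w (T b) (T b ^ l) U)
      p^∣-p^ : ∀ k → (+ p) ℤ.^ k ∣ (ℤ.- + p) ℤ.^ k
      p^∣-p^ zero = ∣-refl
      p^∣-p^ (suc k) = *-∣-* {+ p} {(+ p) ℤ.^ k} (∣m⇒∣-m ∣-refl) (p^∣-p^ k)

    -- Adding residues modulo `p` gives the difference as `c g` minus `p` times a carry. The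
    -- constant disappears under the next difference, and the carry is again a function of `c`, so
    -- `Δ-∣` provides the other `a` factors of `p`.
    Ψ-coordinate : Ψ 0 1 (λ x → + c x)
    Ψ-coordinate [] x a ()
    -- With one difference the constant `c g` would survive; degree 1 makes no claim here.
    Ψ-coordinate (g ∷ []) x a (s≤s ())
    Ψ-coordinate (g ∷ gs@(g′ ∷ gs′)) x a (s≤s lt) = ∣-subst (≡.sym eq)
      (*-∣-* {+ p} {(+ p) ℤ.^ a} (∣m⇒∣-m ∣-refl) (Δ-∣ gs a lt carry-factors x))
      where
      carry : G → ℤ
      carry y = + ((c g ℕ.+ c y) ℕ./ p)
      carry-factors : Factors carry
      carry-factors y z e = ≡.cong (λ t → + ((c g ℕ.+ t) ℕ./ p)) e
      lem : ∀ r q a b p → a ℤ.+ b ≡ r ℤ.+ q ℤ.* p → r ℤ.- b ≡ a ℤ.+ (ℤ.- p) ℤ.* q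
      lem r q a b p e = ≡.trans (lem₁ r q b p)
        (≡.trans (≡.cong (λ t → t ℤ.- b ℤ.- q ℤ.* p) (≡.sym e)) (lem₂ q a b p))
        where
        lem₁ : ∀ r q b p → r ℤ.- b ≡ (r ℤ.+ q ℤ.* p) ℤ.- b ℤ.- q ℤ.* p
        lem₁ = solve-∀
        lem₂ : ∀ q a b p → (a ℤ.+ b) ℤ.- b ℤ.- q ℤ.* p ≡ a ℤ.+ (ℤ.- p) ℤ.* q
        lem₂ = solve-∀
      step : ∀ y → D g (λ z → + c z) y ≡ + c g ℤ.+ (ℤ.- + p) ℤ.* carry y
      step y = ≡.trans (≡.cong (λ t → + t ℤ.- + c y) (c-∙ g y))
        (lem (+ ((c g ℕ.+ c y) ℕ.% p)) (carry y) (+ c g) (+ c y) (+ p)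
          (≡.trans (≡.cong +_ (ℕ.m≡m%n+[m/n]*n (c g ℕ.+ c y) p))
            (≡.cong (λ t → + ((c g ℕ.+ c y) ℕ.% p) ℤ.+ t) (ℤ.pos-* ((c g ℕ.+ c y) ℕ./ p) p))))
      eq : Δ (g ∷ gs) (λ z → + c z) x ≡ (ℤ.- + p) ℤ.* Δ gs carry x
      eq = ≡.trans (Δ-cong gs step x)
        (≡.trans (Δ-+ gs (λ _ → + c g) (λ y → (ℤ.- + p) ℤ.* carry y) x)
        (≡.trans (≡.cong₂ ℤ._+_ (Δ-const g′ gs′ (+ c g) x) (Δ-scale gs (ℤ.- + p) carry x))
          (ℤ.+-identityˡ _)))

-- Sums and products over a finite field.

module Enumerated {q} (K : FiniteField q) where
  open FiniteField K using (Carrier; enumeration)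

  elem : Fin q → Carrier
  elem = Inverse.to enumeration

  index : Carrier → Fin q
  index = Inverse.from enumeration

  elem-index : ∀ x → elem (index x) ≡ x
  elem-index = Inverse.strictlyInverseˡ enumeration

  index-elem : ∀ i → index (elem i) ≡ i
  index-elem = Inverse.strictlyInverseʳ enumeration

  module _ (M : CommutativeMonoid 0ℓ 0ℓ) where
    open CommutativeMonoid M using (_≈_; trans; sym; reflexive) renaming (Carrier to C)
    open MonoidSum M using (sum; sum-permute; sum-cong-≗)

    sum-reindex : (t : Carrier → C) (σ τ : Carrier → Carrier) →
      (∀ x → σ (τ x) ≡ x) → (∀ x → τ (σ x) ≡ x) → sum (t ∘ elem) ≈ sum (t ∘ σ ∘ elem)
    sum-reindex t σ τ στ τσ = trans
      (sum-permute (t ∘ elem) (mk↔ₛ′ (index ∘ σ ∘ elem) (index ∘ τ ∘ elem) (cancel σ τ στ)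
        (cancel τ σ τσ)))
      (reflexive (sum-cong-≗ (λ i → ≡.cong t (elem-index (σ (elem i))))))
      where
      cancel : ∀ σ τ → (∀ x → σ (τ x) ≡ x) → ∀ i → index (σ (elem (index (τ (elem i))))) ≡ i
      cancel σ τ στ i = ≡.trans (≡.cong (index ∘ σ) (elem-index (τ (elem i))))
        (≡.trans (≡.cong index (στ (elem i))) (index-elem i))

module Field {q′ : ℕ} (K : FiniteField (suc q′)) where
  open FiniteField K public hiding (_^_)
  open Enumerated K public

  R : CommutativeRing 0ℓ 0ℓ
  R = record { isCommutativeRing = isCommutativeRing }

  open CommutativeRing R public using (+-comm; +-assoc; *-comm; *-assoc; *-identityˡ; *-identityʳ; +-identityˡ; +-identityʳ; distribˡ; distribʳ; zeroˡ; zeroʳ; -‿inverseˡ; -‿inverseʳ; +-commutativeMonoid; *-commutativeMonoid; commutativeSemiring; semiring; ring)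
  open Exp commutativeSemiring public using (_^_; ^-homo-*; ^-assocʳ)
  open Mult semiring public using (×1-homo-*; ×-assoc-*; ×-congʳ) renaming (_×_ to _·_)
  open SemiringSum semiring public using (sum; sum-cong-≗; ∑-distrib-+; *-distribˡ-sum; *-distribʳ-sum; sum-replicate; sum-replicate-zero; sum-remove; ∑-comm)
  open IntegerMorphism R public using (ι; ι-+; ι-*; ι-neg)
  open IntegerMorphism.Solver R using (solve; _:=_; _:+_; _:*_; :-_)
  open import Algebra.Properties.Ring ring public using (-‿distribˡ-*; -0#≈0#; +-cancelˡ)

  q : ℕ
  q = suc q′

  sum-reindex-+ : (M : CommutativeMonoid 0ℓ 0ℓ)
    (let open CommutativeMonoid M using (_≈_) renaming (Carrier to C)) →
    (t : Carrier → C) (α : Carrier) → MonoidSum.sum M (t ∘ elem) ≈ MonoidSum.sum M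
      (λ i → t (elem i + α))
  sum-reindex-+ M t α = sum-reindex M t (_+ α) (_+ (- α))
    (λ x → ≡.trans (+-assoc _ _ _) (≡.trans (≡.cong (λ t → x + t) (-‿inverseˡ α)) (+-identityʳ x)))
    (λ x → ≡.trans (+-assoc _ _ _) (≡.trans (≡.cong (λ t → x + t) (-‿inverseʳ α)) (+-identityʳ x)))

  -- Translation by `1#` permutes the field, so the sum of all elements is unchanged when `q · 1#`
  -- is added to it.
  q·1≡0 : q · 1# ≡ 0#
  q·1≡0 = +-cancelˡ (sum elem) (q · 1#) 0# (begin
    sum elem + q · 1#                ≡⟨ ≡.cong (λ t → sum elem + t) (sum-replicate q) ⟨
    sum elem + sum {q} (λ _ → 1#)    ≡⟨ ∑-distrib-+ elem (λ _ → 1#) ⟨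
    sum (λ i → elem i + 1#)          ≡⟨ sum-reindex-+ +-commutativeMonoid (λ x → x) 1# ⟨
    sum elem                         ≡⟨ +-identityʳ _ ⟨
    sum elem + 0#                    ∎)
    where open ≡.≡-Reasoning

  no-zero-divisors : ∀ {x y} → x ≢ 0# → x * y ≡ 0# → y ≡ 0#
  no-zero-divisors {x} {y} x≢0 xy≡0 with inverse x x≢0
  ... | z , xz≡1 = begin
    y            ≡⟨ *-identityˡ y ⟨
    1# * y       ≡⟨ ≡.cong (_* y) (≡.trans (*-comm z x) xz≡1) ⟨
    z * x * y    ≡⟨ *-assoc z x y ⟩
    z * (x * y)  ≡⟨ ≡.cong (z *_) xy≡0 ⟩
    z * 0#       ≡⟨ zeroʳ z ⟩
    0#           ∎
    where open ≡.≡-Reasoning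

  char-p : ∀ p n → q ≡ p ℕ.^ n → p · 1# ≡ 0#
  char-p p n q≡p^n with (p · 1#) ≟ 0#
  ... | yes p·1≡0 = p·1≡0
  ... | no p·1≢0 = ⊥-elim (power≢0 n (≡.trans (≡.cong (_· 1#) (≡.sym q≡p^n)) q·1≡0))
    where
    power≢0 : ∀ n → (p ℕ.^ n) · 1# ≢ 0#
    power≢0 zero e = 0≢1 (≡.trans (≡.sym e) (+-identityʳ 1#))
    power≢0 (suc n) e = power≢0 n
      (no-zero-divisors p·1≢0 (≡.trans (≡.sym (×1-homo-* p (p ℕ.^ n))) e))

  private
    i₀ : Fin q
    i₀ = index 0#

    elem-punchIn≢0 : ∀ j → elem (punchIn i₀ j) ≢ 0#
    elem-punchIn≢0 j e = Fin.punchInᵢ≢i i₀ j (≡.trans (≡.sym (index-elem _)) (≡.cong index e))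

    module Π = MonoidSum *-commutativeMonoid

    -- Putting 1 in place of the factor at zero lets the product of the non-zero elements run over
    -- the whole field, where `sum-reindex` applies. `Π.sum` is a product.
    nonZeroOr1 : Carrier → Carrier → Carrier
    nonZeroOr1 y x with x ≟ 0#
    ... | yes _ = 1#
    ... | no _ = y

    nonZeroOr1-0 : ∀ y {x} → x ≡ 0# → nonZeroOr1 y x ≡ 1#
    nonZeroOr1-0 y {x} e with x ≟ 0#
    ... | yes _ = ≡.refl
    ... | no x≢0 = ⊥-elim (x≢0 e)

    nonZeroOr1-≢0 : ∀ y {x} → x ≢ 0# → nonZeroOr1 y x ≡ y
    nonZeroOr1-≢0 y {x} x≢0 with x ≟ 0#
    ... | yes e = ⊥-elim (x≢0 e)
    ... | no _ = ≡.refl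

    nonZeroOr1-nonZero : ∀ x → nonZeroOr1 x x ≢ 0#
    nonZeroOr1-nonZero x e with x ≟ 0#
    ... | yes _ = 0≢1 (≡.sym e)
    ... | no x≢0 = x≢0 e

    product≢0 : ∀ {n} (t : Fin n → Carrier) → (∀ i → t i ≢ 0#) → Π.sum t ≢ 0#
    product≢0 {zero} t H e = 0≢1 (≡.sym e)
    product≢0 {suc n} t H e = product≢0 (t ∘ suc) (H ∘ suc) (no-zero-divisors (H zero) e)

  fermat : ∀ {a} → a ≢ 0# → a ^ q′ ≡ 1#
  fermat {a} a≢0 = ≡.trans (≡.sym weight) (cancel (begin
    P * Π.sum w                             ≡⟨ *-comm P (Π.sum w) ⟩
    Π.sum w * P
      ≡⟨ Π.∑-distrib-+ w (λ i → nonZeroOr1 (elem i) (elem i)) ⟨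
    Π.sum (λ i → w i * nonZeroOr1 (elem i) (elem i)) ≡⟨ Π.sum-cong-≗ (λ i → scaled (elem i)) ⟨
    Π.sum (λ i → nonZeroOr1 (a * elem i) (a * elem i))
      ≡⟨ sum-reindex *-commutativeMonoid (λ x → nonZeroOr1 x x) (a *_) (a⁻¹ *_) (cancelˡ a a⁻¹ aa⁻¹)
      (cancelˡ a⁻¹ a (≡.trans (*-comm a⁻¹ a) aa⁻¹)) ⟨
    P                                       ≡⟨ *-identityʳ P ⟨
    P * 1#                                  ∎))
    where
    open ≡.≡-Reasoning
    a⁻¹ = proj₁ (inverse a a≢0)
    aa⁻¹ = proj₂ (inverse a a≢0)
    P = Π.sum (λ i → nonZeroOr1 (elem i) (elem i))
    w : Fin q → Carrier
    w i = nonZeroOr1 a (elem i)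
    cancelˡ : ∀ b c → b * c ≡ 1# → ∀ x → b * (c * x) ≡ x
    cancelˡ b c bc x = ≡.trans (≡.sym (*-assoc b c x)) (≡.trans (≡.cong (_* x) bc) (*-identityˡ x))
    cancel : ∀ {x} → P * x ≡ P * 1# → x ≡ 1#
    cancel {x} e = ≡.trans (≡.sym (lem x 1#))
      (≡.trans (≡.cong (_+ 1#) (no-zero-divisors (product≢0 _ (λ i → nonZeroOr1-nonZero (elem i)))
      (≡.trans (distribˡ P x (- 1#))
        (≡.trans (≡.cong (_+ P * (- 1#)) e)
        (≡.trans (≡.sym (distribˡ P 1# (- 1#)))
        (≡.trans (≡.cong (P *_) (-‿inverseʳ 1#)) (zeroʳ P))))))) (+-identityˡ 1#))
      where
      lem : ∀ x y → x + (- y) + y ≡ x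
      lem = solve 2 (λ x y → x :+ :- y :+ y := x) ≡.refl
    scaled : ∀ x → nonZeroOr1 (a * x) (a * x) ≡ nonZeroOr1 a x * nonZeroOr1 x x
    scaled x with x ≟ 0#
    ... | yes x≡0 = ≡.trans (nonZeroOr1-0 _ (≡.trans (≡.cong (a *_) x≡0) (zeroʳ a)))
      (≡.sym (*-identityˡ 1#))
    ... | no x≢0 = nonZeroOr1-≢0 _ (λ e → x≢0 (no-zero-divisors a≢0 e))
    weight : Π.sum w ≡ a ^ q′
    weight = begin
      Π.sum w                                        ≡⟨ Π.sum-remove {i = i₀} w ⟩
      w i₀ * Π.sum (λ j → w (punchIn i₀ j))
        ≡⟨ ≡.cong₂ _*_ (nonZeroOr1-0 a (elem-index 0#))
        (Π.sum-cong-≗ (λ j → nonZeroOr1-≢0 a (elem-punchIn≢0 j))) ⟩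
      1# * Π.sum {q′} (λ _ → a)                      ≡⟨ *-identityˡ _ ⟩
      Π.sum {q′} (λ _ → a)                           ≡⟨ Π.sum-replicate q′ ⟩
      a ^ q′                                         ∎

  x^q≡x : ∀ x → x ^ q ≡ x
  x^q≡x x with x ≟ 0#
  ... | yes x≡0 = ≡.trans (≡.cong (_* x ^ q′) x≡0) (≡.trans (zeroˡ _) (≡.sym x≡0))
  ... | no x≢0 = ≡.trans (≡.cong (x *_) (fermat x≢0)) (*-identityʳ x)

  -- By `fermat` each non-zero element contributes 1, and zero contributes 0 as the exponent is
  -- positive. The sum is `q′ · 1#`, that is, minus one.
  sum-x^[q-1]≢0 : 0 < q′ → sum (λ i → elem i ^ q′) ≢ 0#
  sum-x^[q-1]≢0 0<q′ e = 0≢1 (begin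
    0#                                       ≡⟨ q·1≡0 ⟨
    1# + q′ · 1#                             ≡⟨ ≡.cong (λ t → 1# + t) (≡.trans count e) ⟩
    1# + 0#                                  ≡⟨ +-identityʳ 1# ⟩
    1#                                       ∎)
    where
    open ≡.≡-Reasoning
    0^ : ∀ {n x} → 0 < n → x ≡ 0# → x ^ n ≡ 0#
    0^ {suc n} {x} _ e = ≡.trans (≡.cong (_* x ^ n) e) (zeroˡ _)
    count : q′ · 1# ≡ sum (λ i → elem i ^ q′)
    count = begin
      q′ · 1#                                                  ≡⟨ sum-replicate q′ ⟨
      sum {q′} (λ _ → 1#)
        ≡⟨ sum-cong-≗ (λ j → fermat (elem-punchIn≢0 j)) ⟨
      sum (λ j → elem (punchIn i₀ j) ^ q′)                     ≡⟨ +-identityˡ _ ⟨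
      0# + sum (λ j → elem (punchIn i₀ j) ^ q′)
        ≡⟨ ≡.cong (_+ sum (λ j → elem (punchIn i₀ j) ^ q′)) (0^ 0<q′ (elem-index 0#)) ⟨
      elem i₀ ^ q′ + sum (λ j → elem (punchIn i₀ j) ^ q′)
        ≡⟨ sum-remove {i = i₀} (λ i → elem i ^ q′) ⟨
      sum (λ i → elem i ^ q′)                                  ∎

  -- Characteristic p: Frobenius and coordinates over the prime field.

  module Characteristic (m : ℕ) (p-prime : Prime (suc (suc m))) (p·1≡0 : suc (suc m) · 1# ≡ 0#) where

    private
      p : ℕ
      p = suc (suc m)

    frobenius-+ : ∀ x y → (x + y) ^ p ≡ x ^ p + y ^ p
    frobenius-+ x y = begin
      (x + y) ^ p                                                  ≡⟨ proj₂ (proj₂ expansion) ⟩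
      y ^ p + ((p · 1#) * (x * y ^ suc m) + ((p · 1#) * c + x ^ p))
        ≡⟨ ≡.cong₂ (λ s t → y ^ p + (s + (t + x ^ p))) (vanish _) (vanish c) ⟩
      y ^ p + (0# + (0# + x ^ p))
        ≡⟨ ≡.cong (λ t → y ^ p + t) (≡.trans (+-identityˡ _) (+-identityˡ _)) ⟩
      y ^ p + x ^ p                                                ≡⟨ +-comm _ _ ⟩
      x ^ p + y ^ p                                                ∎
      where
      open ≡.≡-Reasoning
      expansion = PrimeBinomial.binomial-prime R (λ _ → ⊤) tt (λ _ _ → tt) m p-prime x y
        (λ _ _ _ → tt)
      c = proj₁ expansion
      vanish : ∀ z → (p · 1#) * z ≡ 0#
      vanish z = ≡.trans (≡.cong (_* z) p·1≡0) (zeroˡ z)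

    ι-p∣ : ∀ z → + p ∣ z → ι z ≡ 0#
    ι-p∣ z (divides k e) = ≡.trans (≡.cong ι e)
      (≡.trans (ι-* k (+ p)) (≡.trans (≡.cong (ι k *_) p·1≡0) (zeroʳ _)))

    ι-cong : ∀ y z → + p ∣ y ℤ.- z → ι y ≡ ι z
    ι-cong y z d = ≡.trans (≡.cong ι (lem y z))
      (≡.trans (ι-+ (y ℤ.- z) z) (≡.trans (≡.cong (_+ ι z) (ι-p∣ (y ℤ.- z) d)) (+-identityˡ _)))
      where
      lem : ∀ y z → y ≡ (y ℤ.- z) ℤ.+ z
      lem = solve-∀

    p∣z-z% : ∀ z → + p ∣ z ℤ.- + (z ℤ.%ℕ p)
    p∣z-z% z = divides (z ℤ./ℕ p)
      (≡.trans (≡.cong (ℤ._- + (z ℤ.%ℕ p)) (ℤ.a≡a%ℕn+[a/ℕn]*n z p)) (lem (+ (z ℤ.%ℕ p)) _))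
      where
      lem : ∀ r y → (r ℤ.+ y) ℤ.- r ≡ y
      lem = solve-∀

    inverse-mod : ∀ z → ¬ (+ p ∣ z) → ∃ λ w → ι w * ι z ≡ 1#
    inverse-mod (+ k) p∤k with coprime-Bézout (prime∤⇒coprime k (λ d → p∤k (∣ᵤ⇒∣ d)))
      where
      prime∤⇒coprime : ∀ k → ¬ (p ℕ∣.∣ k) → Coprime p k
      prime∤⇒coprime k p∤k (d∣p , d∣k) with prime⇒irreducible p-prime d∣p
      ... | inj₁ d≡1 = d≡1
      ... | inj₂ ≡.refl = ⊥-elim (p∤k d∣k)
    ... | Bézout.+- x y e = ℤ.- + y , (begin
        ι (ℤ.- + y) * ι (+ k)           ≡⟨ ≡.cong (_* ι (+ k)) (ι-neg (+ y)) ⟩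
        (- ι (+ y)) * ι (+ k)           ≡⟨ lem (ι (+ y)) (ι (+ k)) 1# ⟩
        1# + (- (1# + ι (+ y) * ι (+ k)))
          ≡⟨ ≡.cong (λ t → 1# + (- t))
          (≡.trans (≡.cong (λ t → 1# + t) (≡.sym (×1-homo-* y k)))
          (≡.trans (≡.cong (_· 1#) e)
          (≡.trans (×1-homo-* x p) (≡.trans (≡.cong (x · 1# *_) p·1≡0) (zeroʳ _))))) ⟩
        1# + (- 0#)                     ≡⟨ ≡.trans (≡.cong (λ t → 1# + t) -0#≈0#) (+-identityʳ 1#) ⟩
        1#                              ∎)
      where
      open ≡.≡-Reasoning
      lem : ∀ y k o → (- y) * k ≡ o + (- (o + y * k))
      lem = solve 3 (λ y k o → (:- y) :* k := o :+ (:- (o :+ y :* k))) ≡.refl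
    ... | Bézout.-+ x y e = + y , (begin
        ι (+ y) * ι (+ k)               ≡⟨ ×1-homo-* y k ⟨
        (y ℕ.* k) · 1#                  ≡⟨ ≡.cong (_· 1#) e ⟨
        1# + (x ℕ.* p) · 1#
          ≡⟨ ≡.cong (λ t → 1# + t) (≡.trans (×1-homo-* x p)
          (≡.trans (≡.cong (x · 1# *_) p·1≡0) (zeroʳ _))) ⟩
        1# + 0#                         ≡⟨ +-identityʳ 1# ⟩
        1#                              ∎)
      where open ≡.≡-Reasoning
    inverse-mod -[1+ k ] p∤ with inverse-mod (+ suc k) (λ d → p∤ (∣m⇒∣-m d))
    ... | w , e = ℤ.- w , ≡.trans (≡.cong (_* (- ι (+ suc k))) (ι-neg w))
      (≡.trans (lem (ι w) (ι (+ suc k))) e)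
      where
      lem : ∀ a b → (- a) * (- b) ≡ a * b
      lem = solve 2 (λ a b → (:- a) :* (:- b) := a :* b) ≡.refl

    -- Scalars are integers acting through `ι`, so no prime field is constructed; independence over
    -- it becomes divisibility of the coefficients by `p`, and coordinates come with integer lifts.
    comb : ∀ {k} → (Fin k → Carrier) → (Fin k → ℤ) → Carrier
    comb b v = sum (λ j → ι (v j) * b j)

    cons : ∀ {a} {A : Set a} {k} → A → (Fin k → A) → Fin (suc k) → A
    cons x v zero = x
    cons x v (suc j) = v j

    comb-+ : ∀ {k} (b : Fin k → Carrier) v w → comb b (λ j → v j ℤ.+ w j) ≡ comb b v + comb b w
    comb-+ b v w = ≡.trans (sum-cong-≗
      (λ j → ≡.trans (≡.cong (_* b j) (ι-+ (v j) (w j))) (distribʳ _ _ _)))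
      (∑-distrib-+ (λ j → ι (v j) * b j) (λ j → ι (w j) * b j))

    comb-scale : ∀ {k} (b : Fin k → Carrier) z v → comb b (λ j → z ℤ.* v j) ≡ ι z * comb b v
    comb-scale b z v = ≡.trans
      (sum-cong-≗ (λ j → ≡.trans (≡.cong (_* b j) (ι-* z (v j))) (*-assoc _ _ _)))
      (≡.sym (*-distribˡ-sum (ι z) (λ j → ι (v j) * b j)))

    comb-neg : ∀ {k} (b : Fin k → Carrier) v → comb b (λ j → ℤ.- v j) ≡ - comb b v
    comb-neg b v = ≡.trans (sum-cong-≗ (λ j → ≡.cong (λ z → ι z * b j) (≡.sym (ℤ.-1*i≡-i (v j)))))
      (≡.trans (comb-scale b ℤ.-1ℤ v) (lem (comb b v)))
      where
      lem : ∀ x → (- (1# + 0#)) * x ≡ - x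
      lem x = ≡.trans (≡.sym (-‿distribˡ-* _ x))
        (≡.cong -_ (≡.trans (≡.cong (_* x) (+-identityʳ 1#)) (*-identityˡ x)))

    comb-0 : ∀ {k} (b : Fin k → Carrier) → comb b (λ _ → + 0) ≡ 0#
    comb-0 {k} b = ≡.trans (sum-cong-≗ (λ j → zeroˡ (b j))) (sum-replicate-zero k)

    InSpan : ∀ {k} → (Fin k → Carrier) → Carrier → Set
    InSpan b x = ∃ λ v → comb b v ≡ x

    Independent : ∀ {k} → (Fin k → Carrier) → Set
    Independent b = ∀ v → comb b v ≡ 0# → ∀ j → + p ∣ v j

    -- A coefficient matters only modulo `p`, so a search over `p` residues for each basis vector
    -- decides membership.
    inSpan? : ∀ {k} (b : Fin k → Carrier) x → Dec (InSpan b x)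
    inSpan? {zero} b x = map′ (λ e → (λ ()) , ≡.sym e) (λ (_ , e) → ≡.sym e) (x ≟ 0#)
    inSpan? {suc k} b x = map′ fwd bwd
      (Fin.any? {n = p} (λ i → inSpan? (b ∘ suc) (x - ι (+ toℕ i) * b zero)))
      where
      lem : ∀ a x → a + (x + (- a)) ≡ x
      lem = solve 2 (λ a x → a :+ (x :+ :- a) := x) ≡.refl
      lem′ : ∀ a c → c ≡ (a + c) + (- a)
      lem′ = solve 2 (λ a c → c := (a :+ c) :+ :- a) ≡.refl
      fwd : (∃ λ i → InSpan (b ∘ suc) (x - ι (+ toℕ {p} i) * b zero)) → InSpan b x
      fwd (i , v , e) = cons (+ toℕ i) v , ≡.trans (≡.cong (λ t → ι (+ toℕ i) * b zero + t) e)
        (lem _ x)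
      bwd : InSpan b x → ∃ λ i → InSpan (b ∘ suc) (x - ι (+ toℕ {p} i) * b zero)
      bwd (v , e) = Fin.fromℕ< r<p , v ∘ suc , ≡.trans (lem′ (ι (v zero) * b zero) _)
          (≡.cong₂ _-_ e (≡.cong (_* b zero)
            (≡.trans (ι-cong (v zero) (+ r) (p∣z-z% (v zero)))
            (≡.cong (λ t → ι (+ t)) (≡.sym (Fin.toℕ-fromℕ< r<p))))))
        where
        r = v zero ℤ.%ℕ p
        r<p : r < p
        r<p = ℤ.n%ℕd<d (v zero) p

    extend : ∀ {k} (b : Fin k → Carrier) x → Independent b → ¬ InSpan b x → Independent (cons x b)
    extend b x ind x∉ v e j with + p ∣? v zero
    ... | no p∤v₀ = ⊥-elim (x∉ ((λ i → ℤ.- (w ℤ.* v (suc i))) , (begin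
        comb b (λ i → ℤ.- (w ℤ.* v (suc i)))
          ≡⟨ ≡.trans (comb-neg b (λ i → w ℤ.* v (suc i))) (≡.cong -_ (comb-scale b w (v ∘ suc))) ⟩
        - (ι w * comb b (v ∘ suc))             ≡⟨ lem (ι w) (ι (v zero)) x (comb b (v ∘ suc)) ⟩
        ι w * ι (v zero) * x - ι w * (ι (v zero) * x + comb b (v ∘ suc))
          ≡⟨ ≡.cong₂ (λ s t → s * x - ι w * t) wv e ⟩
        1# * x - ι w * 0#
          ≡⟨ ≡.cong₂ (λ s t → s - t) (*-identityˡ x) (zeroʳ _) ⟩
        x - 0#
          ≡⟨ ≡.trans (≡.cong (λ t → x + t) -0#≈0#) (+-identityʳ x) ⟩
        x                                      ∎)))
      where
      open ≡.≡-Reasoning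
      w = proj₁ (inverse-mod (v zero) p∤v₀)
      wv = proj₂ (inverse-mod (v zero) p∤v₀)
      lem : ∀ w z x c → - (w * c) ≡ w * z * x - w * (z * x + c)
      lem = solve 4 (λ w z x c → :- (w :* c) := w :* z :* x :+ :- (w :* (z :* x :+ c))) ≡.refl
    extend b x ind x∉ v e zero | yes p∣v₀ = p∣v₀
    extend b x ind x∉ v e (suc j) | yes p∣v₀ = ind (v ∘ suc)
      (≡.trans (≡.sym (+-identityˡ _))
        (≡.trans (≡.cong (_+ comb b (v ∘ suc))
        (≡.sym (≡.trans (≡.cong (_* x) (ι-p∣ (v zero) p∣v₀)) (zeroˡ x)))) e)) j

    greedy : ∀ l (t : Fin l → Carrier) → ∃ λ k → Σ[ b ∈ (Fin k → Carrier) ] Independent b ×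
      (∀ i → InSpan b (t i))
    greedy zero t = 0 , (λ ()) , (λ _ _ ()) , λ ()
    greedy (suc l) t with greedy l (t ∘ suc)
    ... | k , b , ind , span with inSpan? b (t zero)
    ...   | yes t₀∈ = k , b , ind , λ { zero → t₀∈ ; (suc i) → span i }
    ...   | no t₀∉ = suc k , cons (t zero) b , extend b (t zero) ind t₀∉ , λ
      { zero → cons (+ 1) (λ _ → + 0) , ≡.trans
        (≡.cong₂ _+_ (≡.trans (≡.cong (_* t zero) (+-identityʳ 1#)) (*-identityˡ _)) (comb-0 b))
        (+-identityʳ _)
      ; (suc i) → cons (+ 0) (proj₁ (span i)) , ≡.trans (≡.cong₂ _+_ (zeroˡ _) (proj₂ (span i)))
        (+-identityˡ _) }

    basis : ∃ λ k → Σ[ b ∈ (Fin k → Carrier) ] Independent b × (∀ x → InSpan b x)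
    basis with greedy q elem
    ... | k , b , ind , span = k , b , ind , λ x → ≡.subst (InSpan b) (elem-index x)
      (span (index x))

    residue-unique : ∀ {r s} → r < p → s < p → + p ∣ + r ℤ.- + s → r ≡ s
    residue-unique {r} {s} r<p s<p d = ℤ.+-injective
      (ℤ.i-j≡0⇒i≡j (+ r) (+ s) (ℤ.∣i∣≡0⇒i≡0 (small (∣⇒∣ᵤ d) bound)))
      where
      bound : ℤ.∣ + r ℤ.- + s ∣ < p
      bound = ℕ.≤-<-trans (≡.subst (λ z → ℤ.∣ z ∣ ≤ r ℕ.⊔ s) (≡.sym (ℤ.m-n≡m⊖n r s))
        (ℤ.∣m⊝n∣≤m⊔n r s)) (ℕ.⊔-lub r<p s<p)
      small : ∀ {k} → p ℕ∣.∣ k → k < p → k ≡ 0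
      small {zero} _ _ = ≡.refl
      small {suc k} d k<p = ⊥-elim (ℕ.<⇒≱ k<p (ℕ∣.∣⇒≤ d))

    unit : ∀ {k} → Fin k → Fin k → ℤ
    unit zero = cons (+ 1) (λ _ → + 0)
    unit (suc j) = cons (+ 0) (unit j)

    unit-diagonal : ∀ {k} (j : Fin k) → unit j j ≡ + 1
    unit-diagonal zero = ≡.refl
    unit-diagonal (suc j) = unit-diagonal j

    module Coordinates {k} (b : Fin k → Carrier) (independent : Independent b) (spanning : ∀ x → InSpan b x) where
      private
        lift : Carrier → Fin k → ℤ
        lift x = proj₁ (spanning x)

        comb-lift : ∀ x → comb b (lift x) ≡ x
        comb-lift x = proj₂ (spanning x)

      coordinate : Fin k → Carrier → ℕ
      coordinate j x = lift x j ℤ.%ℕ p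

      coordinate<p : ∀ j x → coordinate j x < p
      coordinate<p j x = ℤ.n%ℕd<d (lift x j) p

      lift≡coordinate : ∀ j x → + p ∣ lift x j ℤ.- + coordinate j x
      lift≡coordinate j x = p∣z-z% (lift x j)

      coordinate-+ : ∀ j x y → coordinate j (x + y) ≡ (coordinate j x ℕ.+ coordinate j y) ℕ.% p
      coordinate-+ j x y = residue-unique (coordinate<p j (x + y)) (ℕ.m%n<n c p)
        (≡.subst (+ p ∣_) (lem (lift (x + y) j) (lift x j) (lift y j) (+ coordinate j (x + y))
          (+ coordinate j x) (+ coordinate j y) (+ (c ℕ.% p)))
          (∣m∣n⇒∣m+n (∣m∣n⇒∣m+n (∣m∣n⇒∣m-n relation (lift≡coordinate j (x + y)))
            (∣m∣n⇒∣m+n (lift≡coordinate j x) (lift≡coordinate j y))) reduce))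
        where
        c = coordinate j x ℕ.+ coordinate j y
        relation : + p ∣ lift (x + y) j ℤ.- (lift x j ℤ.+ lift y j)
        relation = independent (λ j → lift (x + y) j ℤ.- (lift x j ℤ.+ lift y j))
          (≡.trans (comb-+ b (lift (x + y)) (λ j → ℤ.- (lift x j ℤ.+ lift y j)))
            (≡.trans (≡.cong₂ _+_ (comb-lift (x + y))
            (≡.trans (comb-neg b (λ j → lift x j ℤ.+ lift y j))
              (≡.cong -_ (≡.trans (comb-+ b (lift x) (lift y))
              (≡.cong₂ _+_ (comb-lift x) (comb-lift y)))))) (-‿inverseʳ _))) j
        reduce : + p ∣ (+ coordinate j x ℤ.+ + coordinate j y) ℤ.- + (c ℕ.% p)
        reduce = divides (+ (c ℕ./ p))
          (≡.trans (≡.cong (λ t → + t ℤ.- + (c ℕ.% p)) (ℕ.m≡m%n+[m/n]*n c p))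
          (≡.trans (≡.cong (λ t → (+ (c ℕ.% p) ℤ.+ t) ℤ.- + (c ℕ.% p)) (ℤ.pos-* (c ℕ./ p) p))
            (lem′ (+ (c ℕ.% p)) _)))
          where
          lem′ : ∀ r y → (r ℤ.+ y) ℤ.- r ≡ y
          lem′ = solve-∀
        lem : ∀ L l l′ C c c′ r → ((L ℤ.- (l ℤ.+ l′)) ℤ.- (L ℤ.- C)) ℤ.+ ((l ℤ.- c) ℤ.+ (l′ ℤ.- c′))
          ℤ.+ ((c ℤ.+ c′) ℤ.- r) ≡ C ℤ.- r
        lem = solve-∀

      -- Supplies the element of residue 1 that `Coordinate` asks for.
      coordinate-unit : ∀ j → coordinate j (comb b (unit j)) ≡ 1
      coordinate-unit j = residue-unique (coordinate<p j x) (s≤s (s≤s z≤n))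
        (≡.subst (+ p ∣_) (≡.trans (lem (lift x j) (unit j j) (+ coordinate j x))
          (≡.cong (λ t → + coordinate j x ℤ.- t) (unit-diagonal j)))
          (∣m∣n⇒∣m-n relation (lift≡coordinate j x)))
        where
        x = comb b (unit j)
        relation : + p ∣ lift x j ℤ.- unit j j
        relation = independent (λ j′ → lift x j′ ℤ.- unit j j′)
          (≡.trans (comb-+ b (lift x) (λ j′ → ℤ.- unit j j′))
          (≡.trans (≡.cong₂ _+_ (comb-lift x) (comb-neg b (unit j))) (-‿inverseʳ x))) j
        lem : ∀ l u c → (l ℤ.- u) ℤ.- (l ℤ.- c) ≡ c ℤ.- u
        lem = solve-∀

      coordinates : ∀ x → sum (λ j → ι (+ coordinate j x) * b j) ≡ x
      coordinates x = ≡.trans (sum-cong-≗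
        (λ j → ≡.cong (_* b j) (≡.sym
        (ι-cong (lift x j) (+ coordinate j x) (lift≡coordinate j x))))) (comb-lift x)

-- Digit sums in base p.

module Digits (m : ℕ) where

  private
    h p : ℕ
    h = suc m
    p = suc h

  digitSum-0 : ∀ k → digitSumFuel p k 0 ≡ 0
  digitSum-0 zero = ≡.refl
  digitSum-0 (suc k) = digitSum-0 k

  -- `s` takes the number itself as fuel, whereas the complement argument is an induction on the
  -- number of digits. Any fuel beyond the last non-zero digit gives the same sum.
  digitSum-fuel : ∀ k l i → i < p ℕ.^ k → i < p ℕ.^ l → digitSumFuel p k i ≡ digitSumFuel p l i
  digitSum-fuel zero l zero _ _ = ≡.sym (digitSum-0 l)
  digitSum-fuel zero l (suc i) (s≤s ()) _
  digitSum-fuel (suc k) zero zero _ _ = digitSum-0 k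
  digitSum-fuel (suc k) zero (suc i) _ (s≤s ())
  digitSum-fuel (suc k) (suc l) i i<k i<l = ≡.cong (i ℕ.% p ℕ.+_)
    (digitSum-fuel k l (i ℕ./ p) (shrink k i<k) (shrink l i<l))
    where
    shrink : ∀ k → i < p ℕ.^ suc k → i ℕ./ p < p ℕ.^ k
    shrink k i<k = ℕ.m<n*o⇒m/o<n (≡.subst (i <_) (ℕ.*-comm p (p ℕ.^ k)) i<k)

  i<p^i : ∀ i → i < p ℕ.^ i
  i<p^i zero = s≤s z≤n
  i<p^i (suc i) = begin
    1 ℕ.+ suc i              ≤⟨ ℕ.+-mono-≤ (ℕ.≤-trans (s≤s z≤n) (i<p^i i)) (i<p^i i) ⟩
    p ℕ.^ i ℕ.+ p ℕ.^ i      ≤⟨ ℕ.+-monoʳ-≤ (p ℕ.^ i) (ℕ.m≤m+n (p ℕ.^ i) (m ℕ.* p ℕ.^ i)) ⟩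
    p ℕ.^ suc i              ∎
    where open ℕ.≤-Reasoning

  digitSum-s : ∀ n i → i < p ℕ.^ n → digitSumFuel p n i ≡ s p i
  digitSum-s n i i<p^n = digitSum-fuel n i i i<p^n (i<p^i i)

  -- All digits of `p ^ n - 1` are `h`, and the addition has no carries: for the last digits,
  -- `r + r′ + 1` is a positive multiple of `p` below `2 p`, hence equal to `p`.
  digitSum-complement : ∀ n i j → suc (i ℕ.+ j) ≡ p ℕ.^ n → digitSumFuel p n i ℕ.+ digitSumFuel p n
    j ≡ n ℕ.* h
  digitSum-complement zero i j e = ≡.refl
  digitSum-complement (suc n) i j e = ≡.trans (swap r a r′ b)
    (≡.cong₂ ℕ._+_ (ℕ.suc-injective r+r′) (digitSum-complement n (i ℕ./ p) (j ℕ./ p) quotients))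
    where
    r = i ℕ.% p
    r′ = j ℕ.% p
    a = digitSumFuel p n (i ℕ./ p)
    b = digitSumFuel p n (j ℕ./ p)
    t = i ℕ./ p ℕ.+ j ℕ./ p
    swap : ∀ r a r′ b → (r ℕ.+ a) ℕ.+ (r′ ℕ.+ b) ≡ (r ℕ.+ r′) ℕ.+ (a ℕ.+ b)
    swap = ℕS.solve-∀
    regroup : ∀ r q r′ q′ p → suc ((r ℕ.+ q ℕ.* p) ℕ.+ (r′ ℕ.+ q′ ℕ.* p)) ≡ (q ℕ.+ q′) ℕ.* p ℕ.+ suc
      (r ℕ.+ r′)
    regroup = ℕS.solve-∀
    total : t ℕ.* p ℕ.+ suc (r ℕ.+ r′) ≡ p ℕ.* p ℕ.^ n
    total = ≡.trans (≡.sym (regroup r (i ℕ./ p) r′ (j ℕ./ p) p))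
      (≡.trans (≡.cong suc (≡.cong₂ ℕ._+_ (≡.sym (ℕ.m≡m%n+[m/n]*n i p))
        (≡.sym (ℕ.m≡m%n+[m/n]*n j p)))) e)
    exactly-p : ∀ {k} → p ℕ∣.∣ suc k → suc k < p ℕ.+ p → suc k ≡ p
    exactly-p (ℕ∣.divides (suc zero) e) _ = ≡.trans e (ℕ.+-identityʳ p)
    exactly-p (ℕ∣.divides (suc (suc c)) e) lt = ⊥-elim
      (ℕ.<⇒≱ lt (≡.subst (p ℕ.+ p ≤_) (≡.sym e) (ℕ.+-monoʳ-≤ p (ℕ.m≤m+n p (c ℕ.* p)))))
    r+r′ : suc (r ℕ.+ r′) ≡ p
    r+r′ = exactly-p (ℕ∣.∣m+n∣m⇒∣n {m = t ℕ.* p}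
      (≡.subst (p ℕ∣.∣_) (≡.sym total) (ℕ∣.m∣m*n (p ℕ.^ n))) (ℕ∣.n∣m*n t))
      (ℕ.+-mono-≤-< (ℕ.m%n<n i p) (ℕ.m%n<n j p))
    quotients : suc t ≡ p ℕ.^ n
    quotients = ℕ.*-cancelˡ-≡ (suc t) (p ℕ.^ n) p
      (≡.trans (ℕ.*-comm p (suc t))
      (≡.trans (ℕ.+-comm p (t ℕ.* p)) (≡.trans (≡.cong (t ℕ.* p ℕ.+_) (≡.sym r+r′)) total)))

  digitSum-positive : ∀ k i → i ≤ k → 0 < i → 0 < digitSumFuel p k i
  digitSum-positive (suc k) i@(suc _) i≤k _ with i ℕ.% p in eq
  ... | suc _ = s≤s z≤n
  ... | zero = digitSum-positive k (i ℕ./ p)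
    (ℕ.s≤s⁻¹ (ℕ.<-≤-trans (ℕ.m/n<m i p (s≤s (s≤s z≤n))) i≤k))
    (ℕ.m≥n⇒m/n>0 (ℕ∣.∣⇒≤ (ℕ∣.m%n≡0⇒n∣m i p eq)))

  s-positive : ∀ i → 0 < i → 0 < s p i
  s-positive i = digitSum-positive i i ℕ.≤-refl

-- The maximum that defines the algebraic degree.

maxFin-upper : ∀ {n} (f : Fin n → ℕ) i → f i ≤ maxFin f
maxFin-upper f zero = ℕ.m≤m⊔n (f zero) _
maxFin-upper f (suc i) = ℕ.≤-trans (maxFin-upper (λ j → f (suc j)) i) (ℕ.m≤n⊔m (f zero) _)

maxFin-least : ∀ {n} (f : Fin n → ℕ) {B} → (∀ i → 2 ℕ.* f i ≤ B) → 2 ℕ.* maxFin f ≤ B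
maxFin-least {zero} f H = z≤n
maxFin-least {suc n} f {B} H = ≡.subst (_≤ B) (≡.sym (ℕ.*-distribˡ-⊔ 2 (f zero) _))
  (ℕ.⊔-lub (H zero) (maxFin-least (λ j → f (suc j)) (λ j → H (suc j))))

module AlgebraicDegree {q} (K : FiniteField q) (p : ℕ) (a : Fin q → FiniteField.Carrier K) where
  open FiniteField K using (0#; _≟_)

  -- Unification recovers the summand that is local to degAlg.
  private
    unfolded : ∃ λ (f : Fin q → ℕ) → degAlg K p a ≡ maxFin f
    unfolded = _ , ≡.refl

  contribution : Fin q → ℕ
  contribution = proj₁ unfolded

  contribution-≢0 : ∀ i → a i ≢ 0# → contribution i ≡ s p (toℕ i)
  contribution-≢0 i ne with a i ≟ 0#
  ... | yes e = ⊥-elim (ne e)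
  ... | no _ = ≡.refl

  degAlg-upper : ∀ i → a i ≢ 0# → s p (toℕ i) ≤ degAlg K p a
  degAlg-upper i ne = ≡.subst (_≤ degAlg K p a) (contribution-≢0 i ne) (maxFin-upper contribution i)

  degAlg-least : ∀ {B} → (∀ i → a i ≢ 0# → 2 ℕ.* s p (toℕ i) ≤ B) → 2 ℕ.* degAlg K p a ≤ B
  degAlg-least {B} H = maxFin-least contribution bound
    where
    bound : ∀ i → 2 ℕ.* contribution i ≤ B
    bound i with a i ≟ 0#
    ... | yes e = z≤n
    ... | no ne = H i ne

-- Moments of the graph of a planar function.

module Moments {q′ : ℕ} (K : FiniteField (suc q′)) (m n : ℕ) (p-prime : Prime (suc (suc m)))
  (q≡p^n : suc q′ ≡ suc (suc m) ℕ.^ n) where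

  open Field K
  open IntegerMorphism.Solver R using (solve; _:=_; _:+_; _:*_; :-_)

  private
    h p : ℕ
    h = suc m
    p = suc h

    p·1≡0 : p · 1# ≡ 0#
    p·1≡0 = char-p p n q≡p^n

  open Characteristic m p-prime p·1≡0

  Pair : Set
  Pair = Carrier × Carrier

  infixl 6 _∙_
  _∙_ : Pair → Pair → Pair
  (x , y) ∙ (x′ , y′) = (x + x′) , (y + y′)

  inv : Pair → Pair
  inv (x , y) = (- x) , (- y)

  isAbelianGroup : IsAbelianGroup _≡_ _∙_ (0# , 0#) inv
  isAbelianGroup = record
    { isGroup = record
      { isMonoid = record
        { isSemigroup = record
          { isMagma = record { isEquivalence = ≡.isEquivalence ; ∙-cong = ≡.cong₂ _∙_ }
          ; assoc = λ (x , y) (x′ , y′) (x″ , y″) → ≡.cong₂ _,_ (+-assoc x x′ x″) (+-assoc y y′ y″)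
            }
        ; identity = (λ (x , y) → ≡.cong₂ _,_ (+-identityˡ x) (+-identityˡ y))
                   , (λ (x , y) → ≡.cong₂ _,_ (+-identityʳ x) (+-identityʳ y)) }
      ; inverse = (λ (x , y) → ≡.cong₂ _,_ (-‿inverseˡ x) (-‿inverseˡ y))
                , (λ (x , y) → ≡.cong₂ _,_ (-‿inverseʳ x) (-‿inverseʳ y))
      ; ⁻¹-cong = ≡.cong inv }
    ; comm = λ (x , y) (x′ , y′) → ≡.cong₂ _,_ (+-comm x x′) (+-comm y y′) }

  open GroupRing isAbelianGroup

  p·x≡0 : ∀ x → p · x ≡ 0#
  p·x≡0 x = ≡.trans (×-congʳ p (≡.sym (*-identityˡ x)))
    (≡.trans (≡.sym (×-assoc-* p 1# x)) (≡.trans (≡.cong (_* x) p·1≡0) (zeroˡ x)))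

  ⋆-components : ∀ k x y → k ⋆ (x , y) ≡ (k · x , k · y)
  ⋆-components zero x y = ≡.refl
  ⋆-components (suc k) x y = ≡.cong ((x , y) ∙_) (⋆-components k x y)

  p-torsion : ∀ g → p ⋆ g ≡ (0# , 0#)
  p-torsion (x , y) = ≡.trans (⋆-components p x y) (≡.cong₂ _,_ (p·x≡0 x) (p·x≡0 y))

  open ModP m p-prime p-torsion hiding (frobenius)
  open Polynomials isAbelianGroup m p-prime p-torsion

  private
    module A = CommutativeRing groupRing
    module ΣA = SemiringSum A.semiring
    open Mult A.semiring using () renaming (_×_ to _·ᴬ_; ×1-homo-* to ·ᴬ1-homo-*; ×-assoc-* to ·ᴬ-assoc-*; ×-congʳ to ·ᴬ-congʳ)

  -- The field-valued counterpart of `Ψ 0 e`: the K-linear span of the reductions of integer-valued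
  -- test functions. `≗-resp` replaces function extensionality.
  data Deg (e : ℕ) : (Pair → Carrier) → Set where
    term : ∀ κ {ψ} → Ψ 0 e ψ → Deg e (λ g → ι (ψ g) * κ)
    null : Deg e (λ _ → 0#)
    _⊹_  : ∀ {φ φ′} → Deg e φ → Deg e φ′ → Deg e (λ g → φ g + φ′ g)
    ≗-resp : ∀ {φ φ′} → (∀ g → φ g ≡ φ′ g) → Deg e φ → Deg e φ′

  Deg-1 : Deg 0 (λ _ → 1#)
  Deg-1 = ≗-resp (λ _ → ≡.trans (*-identityʳ _) (+-identityʳ 1#))
    (term 1# {λ _ → + 1} (Ψ-const (+ 1)))

  Deg-* : ∀ {e e′ φ φ′} → Deg e φ → Deg e′ φ′ → Deg (e ℕ.+ e′) (λ g → φ g * φ′ g)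
  Deg-* {e} {e′} (term κ {ψ} P) (term κ′ {ψ′} P′) = ≗-resp
    (λ g → ≡.trans (≡.cong (_* (κ * κ′)) (ι-* (ψ g) (ψ′ g))) (lem (ι (ψ g)) (ι (ψ′ g)) κ κ′))
    (term (κ * κ′) {λ g → ψ g ℤ.* ψ′ g} (Ψ-* {0} {e} {0} {e′} {ψ} {ψ′} P P′))
    where
    lem : ∀ a b c d → (a * b) * (c * d) ≡ (a * c) * (b * d)
    lem = solve 4 (λ a b c d → (a :* b) :* (c :* d) := (a :* c) :* (b :* d)) ≡.refl
  Deg-* (term κ P) null = ≗-resp (λ g → ≡.sym (zeroʳ _)) null
  Deg-* F@(term κ P) (G ⊹ G′) = ≗-resp (λ g → ≡.sym (distribˡ _ _ _)) (Deg-* F G ⊹ Deg-* F G′)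
  Deg-* F@(term κ {ψ} P) (≗-resp eq G) = ≗-resp (λ g → ≡.cong (ι (ψ g) * κ *_) (eq g)) (Deg-* F G)
  Deg-* null G = ≗-resp (λ g → ≡.sym (zeroˡ _)) null
  Deg-* (F ⊹ F′) G = ≗-resp (λ g → ≡.sym (distribʳ _ _ _)) (Deg-* F G ⊹ Deg-* F′ G)
  Deg-* {φ′ = φ′} (≗-resp eq F) G = ≗-resp (λ g → ≡.cong (_* φ′ g) (eq g)) (Deg-* F G)

  Deg-sum : ∀ {e k} (φ : Fin k → Pair → Carrier) → (∀ j → Deg e (φ j)) → Deg e
    (λ g → sum (λ j → φ j g))
  Deg-sum {k = zero} φ D = null
  Deg-sum {k = suc k} φ D = D zero ⊹ Deg-sum (φ ∘ suc) (D ∘ suc)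

  Deg-^ : ∀ {φ} → Deg 1 φ → ∀ r → Deg r (λ g → φ g ^ r)
  Deg-^ F zero = Deg-1
  Deg-^ F (suc r) = Deg-* F (Deg-^ F r)

  Additive : (Carrier → Carrier) → Set
  Additive M = ∀ x y → M (x + y) ≡ M x + M y

  module _ {M : Carrier → Carrier} (M-+ : Additive M) where

    additive-0 : M 0# ≡ 0#
    additive-0 = +-cancelˡ (M 0#) (M 0#) 0#
      (≡.trans (≡.sym (M-+ 0# 0#)) (≡.trans (≡.cong M (+-identityˡ 0#)) (≡.sym (+-identityʳ _))))

    additive-ι : ∀ k y → M (ι (+ k) * y) ≡ ι (+ k) * M y
    additive-ι zero y = ≡.trans (≡.cong M (zeroˡ y)) (≡.trans additive-0 (≡.sym (zeroˡ _)))
    additive-ι (suc k) y = begin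
      M ((1# + ι (+ k)) * y)
        ≡⟨ ≡.cong M (≡.trans (distribʳ _ _ _) (≡.cong (_+ ι (+ k) * y) (*-identityˡ y))) ⟩
      M (y + ι (+ k) * y)
        ≡⟨ ≡.trans (M-+ _ _) (≡.cong₂ _+_ (≡.sym (*-identityˡ _)) (additive-ι k y)) ⟩
      1# * M y + ι (+ k) * M y    ≡⟨ distribʳ _ _ _ ⟨
      ι (+ suc k) * M y           ∎
      where open ≡.≡-Reasoning

    additive-sum : ∀ {k} (t : Fin k → Carrier) → M (sum t) ≡ sum (M ∘ t)
    additive-sum {zero} t = additive-0
    additive-sum {suc k} t = ≡.trans (M-+ _ _)
      (≡.cong (λ z → M (t zero) + z) (additive-sum (t ∘ suc)))

  module Projection (π : Pair → Carrier) (π-∙ : ∀ g g′ → π (g ∙ g′) ≡ π g + π g′)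
    (section : Carrier → Pair) (π-section : ∀ x → π (section x) ≡ x) where

    private
      k = proj₁ basis
      b = proj₁ (proj₂ basis)
    open Coordinates b (proj₁ (proj₂ (proj₂ basis))) (proj₂ (proj₂ (proj₂ basis)))

    Ψ-coordinate-π : ∀ j → Ψ 0 1 (λ g → + coordinate j (π g))
    Ψ-coordinate-π j = Coordinate.Ψ-coordinate (coordinate j ∘ π) (λ g → coordinate<p j (π g))
      (λ g g′ → ≡.trans (≡.cong (coordinate j) (π-∙ g g′)) (coordinate-+ j (π g) (π g′)))
      (section (comb b (unit j)))
        (≡.trans (≡.cong (coordinate j) (π-section _)) (coordinate-unit j))

    -- An additive map is a linear combination of coordinates with the constants `M (b j)`, and each
    -- lifted coordinate has degree 1.
    Deg-additive : ∀ M → Additive M → Deg 1 (M ∘ π)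
    Deg-additive M M-+ = ≗-resp eq (Deg-sum (λ j g → ι (+ coordinate j (π g)) * M (b j))
        (λ j → term (M (b j)) {λ g → + coordinate j (π g)} (Ψ-coordinate-π j)))
      where
      eq : ∀ g → sum (λ j → ι (+ coordinate j (π g)) * M (b j)) ≡ M (π g)
      eq g = ≡.trans (sum-cong-≗ (λ j → ≡.sym (additive-ι M-+ (coordinate j (π g)) (b j))))
        (≡.trans (≡.sym (additive-sum M-+ (λ j → ι (+ coordinate j (π g)) * b j)))
          (≡.cong M (coordinates (π g))))

    -- The lowest digit contributes that many factors of degree 1. The remaining digits see the p-th
    -- power of `M`, again additive by `frobenius-+`; this is why the statement ranges over all
    -- additive `M`.
    Deg-digits : ∀ fuel t → t ≤ fuel → ∀ M → Additive M → Deg (digitSumFuel p fuel t)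
      (λ g → M (π g) ^ t)
    Deg-digits zero zero _ M M-+ = Deg-1
    Deg-digits (suc fuel) t t≤ M M-+ = ≗-resp eq
      (Deg-* (Deg-^ (Deg-additive M M-+) (t ℕ.% p))
             (Deg-digits fuel (t ℕ./ p) (shrink t t≤) (λ x → M x ^ p)
               (λ x y → ≡.trans (≡.cong (_^ p) (M-+ x y)) (frobenius-+ (M x) (M y)))))
      where
      shrink : ∀ t → t ≤ suc fuel → t ℕ./ p ≤ fuel
      shrink zero _ = z≤n
      shrink t@(suc _) t≤ = ℕ.s≤s⁻¹ (ℕ.<-≤-trans (ℕ.m/n<m t p (s≤s (s≤s z≤n))) t≤)
      eq : ∀ g → M (π g) ^ (t ℕ.% p) * (M (π g) ^ p) ^ (t ℕ./ p) ≡ M (π g) ^ t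
      eq g = begin
        x ^ (t ℕ.% p) * (x ^ p) ^ (t ℕ./ p)
          ≡⟨ ≡.cong (x ^ (t ℕ.% p) *_) (^-assocʳ x p (t ℕ./ p)) ⟩
        x ^ (t ℕ.% p) * x ^ (p ℕ.* (t ℕ./ p))   ≡⟨ ^-homo-* x (t ℕ.% p) (p ℕ.* (t ℕ./ p)) ⟨
        x ^ (t ℕ.% p ℕ.+ p ℕ.* (t ℕ./ p))
          ≡⟨ ≡.cong (x ^_) (≡.trans (≡.cong (t ℕ.% p ℕ.+_) (ℕ.*-comm p (t ℕ./ p)))
          (≡.sym (ℕ.m≡m%n+[m/n]*n t p))) ⟩
        x ^ t                                   ∎
        where
        open ≡.≡-Reasoning
        x = M (π g)

    Deg-power : ∀ t → Deg (s p t) (λ g → π g ^ t)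
    Deg-power t = Deg-digits t t ℕ.≤-refl (λ x → x) (λ _ _ → ≡.refl)

  module First = Projection proj₁ (λ _ _ → ≡.refl) (_, 0#) (λ _ → ≡.refl)
  module Second = Projection proj₂ (λ _ _ → ≡.refl) (0# ,_) (λ _ → ≡.refl)

  points : ∀ {l} → (Fin l → Pair) → Expr
  points pt = ΣA.sum (λ i → [ pt i ])

  ι-act-points : ∀ {l} (pt : Fin l → Pair) ψ → ι (act (points pt) ψ (0# , 0#)) ≡ sum
    (λ i → ι (ψ (pt i)))
  ι-act-points {zero} pt ψ = ≡.refl
  ι-act-points {suc l} pt ψ = ≡.trans (ι-+ (ψ (pt zero ∙ (0# , 0#))) _)
    (≡.cong₂ _+_ (≡.cong (ι ∘ ψ) (IsAbelianGroup.identityʳ isAbelianGroup (pt zero)))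
      (ι-act-points (pt ∘ suc) ψ))

  annihilate : ∀ {l d e φ} (pt : Fin l → Pair) → Sat d (points pt) → e < d → Deg e φ → sum (φ ∘ pt)
    ≡ 0#
  annihilate {e = e} pt S e<d (term κ {ψ} P) = begin
    sum (λ i → ι (ψ (pt i)) * κ)               ≡⟨ *-distribʳ-sum κ (λ i → ι (ψ (pt i))) ⟨
    sum (λ i → ι (ψ (pt i))) * κ               ≡⟨ ≡.cong (_* κ) (ι-act-points pt ψ) ⟨
    ι (act (points pt) ψ (0# , 0#)) * κ
      ≡⟨ ≡.cong (_* κ) (ι-p∣ _ (Sat-Ψ {e = e} {φ = ψ} S P e<d (0# , 0#))) ⟩
    0# * κ                                     ≡⟨ zeroˡ κ ⟩
    0#                                         ∎
    where open ≡.≡-Reasoning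
  annihilate {l} pt S e<d null = sum-replicate-zero l
  annihilate pt S e<d (_⊹_ {φ} {φ′} P Q) = ≡.trans (∑-distrib-+ (φ ∘ pt) (φ′ ∘ pt))
    (≡.trans (≡.cong₂ _+_ (annihilate pt S e<d P) (annihilate pt S e<d Q)) (+-identityˡ 0#))
  annihilate pt S e<d (≗-resp eq P) = ≡.trans (sum-cong-≗ (λ i → ≡.sym (eq (pt i))))
    (annihilate pt S e<d P)

  Sat-sum : ∀ {d l} (t : Fin l → Expr) → (∀ i → Sat d (t i)) → Sat d (ΣA.sum t)
  Sat-sum {d} {zero} t H = Fil⇒Sat (Fil-0 d)
  Sat-sum {d} {suc l} t H = Sat-+ (H zero) (Sat-sum (t ∘ suc) (H ∘ suc))

  Fil-p^ : ∀ k → Fil (k ℕ.* h) ((p ℕ.^ k) ·ᴬ [ 0# , 0# ])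
  Fil-p^ zero = all _
  Fil-p^ (suc k) = ext (A.sym (·ᴬ1-homo-* p (p ℕ.^ k))) (Fil-π (Fil-p^ k))

  Sat-q : Sat (n ℕ.* h) (q ·ᴬ [ 0# , 0# ])
  Sat-q = Fil⇒Sat (≡.subst (λ t → Fil (n ℕ.* h) (t ·ᴬ [ 0# , 0# ])) (≡.sym q≡p^n) (Fil-p^ n))

  module Line (emb : Carrier → Pair) (emb-+ : ∀ x y → emb (x + y) ≡ emb x ∙ emb y) where

    line : Expr
    line = points (emb ∘ elem)

    line-shift : ∀ a → [ emb a ] ⊠ line ≈ line
    line-shift a = A.trans (ΣA.*-distribˡ-sum [ emb a ] (λ i → [ emb (elem i) ]))
      (A.trans (ΣA.sum-cong-≋ (λ i → A.trans ([∙] (emb a) (emb (elem i)))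
        (A.reflexive (≡.cong [_] (≡.trans (≡.sym (emb-+ a (elem i)))
        (≡.cong emb (+-comm a (elem i))))))))
        (A.sym (sum-reindex-+ A.+-commutativeMonoid (λ x → [ emb x ]) a)))

    line² : line ⊠ line ≈ (q ·ᴬ [ 0# , 0# ]) ⊠ line
    line² = A.trans (ΣA.*-distribʳ-sum line (λ i → [ emb (elem i) ]))
      (A.trans (ΣA.sum-cong-≋ (λ i → line-shift (elem i)))
        (A.trans (ΣA.sum-replicate q)
          (A.trans (·ᴬ-congʳ q (A.sym (A.*-identityˡ line)))
          (A.sym (·ᴬ-assoc-* q [ 0# , 0# ] line)))))

    -- Points of a subgroup fix the sum over it, so `line` is idempotent up to the factor `q`, which
    -- has weight `n h`.
    Sat-line : Sat (n ℕ.* h) line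
    Sat-line = Sat-idempotent line² Sat-q (n ℕ.* h) ℕ.≤-refl

  module XAxis = Line (_, 0#) (λ x y → ≡.cong (x + y ,_) (≡.sym (+-identityˡ 0#)))
  module YAxis = Line (0# ,_) (λ x y → ≡.cong (_, x + y) (≡.sym (+-identityˡ 0#)))

  power-sum : ∀ t → s p t < n ℕ.* h → sum (λ i → elem i ^ t) ≡ 0#
  power-sum t st< = annihilate (λ i → elem i , 0#) XAxis.Sat-line st< (First.Deg-power t)

  module Graph (F : Carrier → Carrier) (F-planar : Planar F) (half : ℕ) (h-even : h ≡ half ℕ.+ half) where

    open Odd half h-even

    graph : Expr
    graph = points (λ i → elem i , F (elem i))

    bar-sum : ∀ {l} (t : Fin l → Expr) → bar (ΣA.sum t) ≡ ΣA.sum (bar ∘ t)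
    bar-sum {zero} t = ≡.refl
    bar-sum {suc l} t = ≡.cong (bar (t zero) ⊞_) (bar-sum (t ∘ suc))

    slice : Carrier → Carrier → Pair
    slice α x = α , F (x + α) - F x

    -- The product runs over pairs of graph points; it is sorted by the difference of their first
    -- coordinates.
    norm-expansion : bar graph ⊠ graph ≈ ΣA.sum (λ j → points (slice (elem j) ∘ elem))
    norm-expansion = begin
      bar graph ⊠ graph
        ≡⟨ ≡.cong (_⊠ graph) (bar-sum (λ i → [ elem i , F (elem i) ])) ⟩
      ΣA.sum (λ i → [ inv (elem i , F (elem i)) ]) ⊠ graph
        ≈⟨ ΣA.*-distribʳ-sum graph (λ i → [ inv (elem i , F (elem i)) ]) ⟩
      ΣA.sum (λ i → [ inv (elem i , F (elem i)) ] ⊠ graph)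
        ≈⟨ ΣA.sum-cong-≋ (λ i → row (elem i)) ⟩
      ΣA.sum (λ i → ΣA.sum (λ j → [ slice (elem j) (elem i) ]))
        ≈⟨ ΣA.∑-comm (λ i j → [ slice (elem j) (elem i) ]) ⟩
      ΣA.sum (λ j → points (slice (elem j) ∘ elem)) ∎
      where
      open import Relation.Binary.Reasoning.Setoid A.setoid
      lem : ∀ x α → (- x) + (α + x) ≡ α
      lem = solve 2 (λ x α → (:- x) :+ (α :+ x) := α) ≡.refl
      row : ∀ x → [ inv (x , F x) ] ⊠ graph ≈ ΣA.sum (λ j → [ slice (elem j) x ])
      row x = begin
        [ inv (x , F x) ] ⊠ graph
          ≈⟨ ΣA.*-distribˡ-sum [ inv (x , F x) ] (λ j → [ elem j , F (elem j) ]) ⟩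
        ΣA.sum (λ j → [ inv (x , F x) ] ⊠ [ elem j , F (elem j) ])
          ≈⟨ ΣA.sum-cong-≋ (λ j → [∙] (inv (x , F x)) (elem j , F (elem j))) ⟩
        ΣA.sum (λ j → [ inv (x , F x) ∙ (elem j , F (elem j)) ])
          -- After this substitution `elem j` is the difference of first coordinates rather than the
          -- second point.
          ≈⟨ sum-reindex-+ A.+-commutativeMonoid (λ y → [ inv (x , F x) ∙ (y , F y) ]) x ⟩
        ΣA.sum (λ j → [ inv (x , F x) ∙ (elem j + x , F (elem j + x)) ])
          ≡⟨ ΣA.sum-cong-≗ (λ j → ≡.cong [_]
            (≡.cong₂ _,_ (lem x (elem j))
            (≡.trans (+-comm _ _) (≡.cong (λ z → F z - F x) (+-comm (elem j) x))))) ⟩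
        ΣA.sum (λ j → [ slice (elem j) x ]) ∎

    Sat-slice-0 : ∀ {α} → α ≡ 0# → Sat (n ℕ.* h) (points (slice α ∘ elem))
    Sat-slice-0 {α} α≡0 = Sat-ext
      (A.sym (A.trans (A.reflexive (ΣA.sum-cong-≗ (λ i → ≡.cong [_] (trivial (elem i)))))
      (ΣA.sum-replicate q))) Sat-q
      where
      trivial : ∀ x → slice α x ≡ (0# , 0#)
      trivial x = ≡.cong₂ _,_ α≡0
        (≡.trans (≡.cong (λ y → F y - F x) (≡.trans (≡.cong (λ t → x + t) α≡0) (+-identityʳ x)))
        (-‿inverseʳ (F x)))

    -- Here planarity enters: `F (x + α) - F x - F α` takes every value exactly once, so the slice
    -- is the vertical line over `α`, a translate of the y-axis.
    Sat-slice-≢0 : ∀ {α} → α ≢ 0# → Sat (n ℕ.* h) (points (slice α ∘ elem))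
    Sat-slice-≢0 {α} α≢0 = Sat-ext (A.sym eq) (Sat-scale [ α , 0# ] YAxis.Sat-line)
      where
      open import Relation.Binary.Reasoning.Setoid A.setoid
      injective = proj₁ (F-planar α α≢0)
      surjective = proj₂ (F-planar α α≢0)
      σ : Carrier → Carrier
      σ x = F (x + α) - F x - F α
      τ : Carrier → Carrier
      τ y = proj₁ (surjective y)
      στ : ∀ y → σ (τ y) ≡ y
      στ y = proj₂ (surjective y) ≡.refl
      lem : ∀ a b → a + (- b) + b ≡ a
      lem = solve 2 (λ a b → a :+ (:- b) :+ b := a) ≡.refl
      eq : points (slice α ∘ elem) ≈ [ α , 0# ] ⊠ YAxis.line
      eq = begin
        ΣA.sum (λ i → [ slice α (elem i) ])
          ≡⟨ ΣA.sum-cong-≗ {q} (λ i → ≡.cong (λ z → [ α , z ])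
            (≡.sym (lem (F (elem i + α) - F (elem i)) (F α)))) ⟩
        ΣA.sum (λ i → [ α , σ (elem i) + F α ])
          ≈⟨ sum-reindex A.+-commutativeMonoid (λ z → [ α , z + F α ]) σ τ στ
            (λ x → injective (στ (σ x))) ⟨
        ΣA.sum (λ i → [ α , elem i + F α ])
          ≈⟨ sum-reindex-+ A.+-commutativeMonoid (λ z → [ α , z ]) (F α) ⟨
        ΣA.sum (λ i → [ α , elem i ])
          ≈⟨ ΣA.sum-cong-≋ (λ i → A.trans ([∙] (α , 0#) (0# , elem i))
            (A.reflexive (≡.cong [_] (≡.cong₂ _,_ (+-identityʳ α) (+-identityˡ (elem i)))))) ⟨
        ΣA.sum (λ i → [ α , 0# ] ⊠ [ 0# , elem i ])
          ≈⟨ ΣA.*-distribˡ-sum [ α , 0# ] (λ i → [ 0# , elem i ]) ⟨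
        [ α , 0# ] ⊠ YAxis.line ∎

    Sat-slice : ∀ α → Dec (α ≡ 0#) → Sat (n ℕ.* h) (points (slice α ∘ elem))
    Sat-slice α (yes α≡0) = Sat-slice-0 α≡0
    Sat-slice α (no α≢0) = Sat-slice-≢0 α≢0

    Sat-graph : ∀ d → d ℕ.+ d ≤ suc (n ℕ.* h) → Sat d graph
    Sat-graph = Sat-norm (Sat-ext (A.sym norm-expansion)
      (Sat-sum _ (λ j → Sat-slice (elem j) (elem j ≟ 0#))))

    moment : ∀ k l → (s p k ℕ.+ s p l) ℕ.+ (s p k ℕ.+ s p l) < n ℕ.* h → sum
      (λ i → elem i ^ k * F (elem i) ^ l) ≡ 0#
    moment k l lt = annihilate (λ i → elem i , F (elem i))
      -- Weight `e + 1` is available exactly when `2 (e + 1) ≤ n h + 1`, that is, when `2 e < n h`.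
      (Sat-graph (suc e) (≡.subst (_≤ suc (n ℕ.* h)) (≡.cong suc (≡.sym (ℕ.+-suc e e))) (s≤s lt)))
      (ℕ.n<1+n e) (Deg-* (First.Deg-power k) (Second.Deg-power l))
      where e = s p k ℕ.+ s p l

  -- From moments to coefficients of the composite.

  open Digits m using (digitSum-s; digitSum-complement)

  s-complement : ∀ i j → i ℕ.+ j ≡ q′ → s p i ℕ.+ s p j ≡ n ℕ.* h
  s-complement i j e = ≡.trans
    (≡.cong₂ ℕ._+_ (≡.sym (digitSum-s n i (below i (ℕ.m≤m+n i j))))
    (≡.sym (digitSum-s n j (below j (ℕ.m≤n+m j i)))))
    (digitSum-complement n i j (≡.trans (≡.cong suc e) q≡p^n))
    where
    below : ∀ k → k ≤ i ℕ.+ j → k < p ℕ.^ n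
    below k k≤ = ≡.subst (k <_) q≡p^n (s≤s (≡.subst (k ≤_) e k≤))

  sum-x^t≡0 : ∀ t → t < q′ → sum (λ i → elem i ^ t) ≡ 0#
  sum-x^t≡0 t t<q′ = power-sum t
    (≡.subst (s p t <_) (s-complement t (q′ ∸ t) (ℕ.m+[n∸m]≡n (ℕ.<⇒≤ t<q′)))
    (ℕ.m<m+n (s p t) (Digits.s-positive m (q′ ∸ t) (ℕ.m<n⇒0<n∸m t<q′))))

  -- Below `i₀` the exponent is less than `q - 1`. Above, it is `q + c`, and `x ^ q = x` lowers it
  -- to `c + 1`, which is still less than `q - 1` because `i₀` is positive; with `i₀ = 0` and
  -- `i = q - 1` it would be `q - 1` and the sum would not vanish.
  sum-x^[i+j]≡0 : ∀ i₀ j → i₀ ℕ.+ j ≡ q′ → 0 < i₀ → ∀ i → i ≤ q′ → i ≢ i₀ → sum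
    (λ x → elem x ^ (i ℕ.+ j)) ≡ 0#
  sum-x^[i+j]≡0 i₀ j e 0<i₀ i i≤q′ i≢i₀ with ℕ.<-cmp i i₀
  ... | tri< i<i₀ _ _ = sum-x^t≡0 (i ℕ.+ j) (≡.subst (i ℕ.+ j <_) e (ℕ.+-monoˡ-< j i<i₀))
  ... | tri≈ _ i≡i₀ _ = ⊥-elim (i≢i₀ i≡i₀)
  ... | tri> _ _ i₀<i = ≡.trans (sum-cong-≗ (λ x → reduce (elem x))) (sum-x^t≡0 (suc c) suc-c<q′)
    where
    c = i ∸ suc i₀
    i≡ : suc i₀ ℕ.+ c ≡ i
    i≡ = ℕ.m+[n∸m]≡n i₀<i
    exponent : i ℕ.+ j ≡ q ℕ.+ c
    exponent = ≡.trans (≡.cong (ℕ._+ j) (≡.sym i≡))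
      (≡.trans (lem i₀ c j) (≡.cong (λ t → suc t ℕ.+ c) e))
      where
      lem : ∀ i₀ c j → suc i₀ ℕ.+ c ℕ.+ j ≡ suc (i₀ ℕ.+ j) ℕ.+ c
      lem = ℕS.solve-∀
    reduce : ∀ x → x ^ (i ℕ.+ j) ≡ x ^ suc c
    reduce x = ≡.trans (≡.cong (x ^_) exponent)
      (≡.trans (^-homo-* x q c) (≡.cong (_* x ^ c) (x^q≡x x)))
    suc-c<q′ : suc c < q′
    suc-c<q′ = ℕ.<-≤-trans (≡.subst (suc c <_) (≡.trans (ℕ.+-suc i₀ c) i≡) (ℕ.m<n+m (suc c) 0<i₀))
      i≤q′

  ^-agrees : ∀ x i → FiniteField._^_ K x i ≡ x ^ i
  ^-agrees x zero = ≡.refl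
  ^-agrees x (suc i) = ≡.cong (x *_) (^-agrees x i)

  Σ-agrees : ∀ {k} (t : Fin k → Carrier) → Σ t ≡ sum t
  Σ-agrees {zero} t = ≡.refl
  Σ-agrees {suc k} t = ≡.cong (λ z → t zero + z) (Σ-agrees (t ∘ suc))

  interpolate : ∀ H a → IsInterpolation H a → ∀ x → H x ≡ sum (λ i → a i * x ^ toℕ i)
  interpolate H a I x = ≡.trans (I x) (≡.trans (Σ-agrees (λ i → a i * FiniteField._^_ K x (toℕ i)))
    (sum-cong-≗ (λ i → ≡.cong (a i *_) (^-agrees x (toℕ i)))))

  weighted-sum : ∀ {k} (w y : Fin q → Carrier) (a : Fin k → Carrier) (e : Fin k → ℕ) →
    sum (λ x → w x * sum (λ i → a i * y x ^ e i)) ≡ sum (λ i → a i * sum (λ x → w x * y x ^ e i))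
  weighted-sum w y a e = begin
    sum (λ x → w x * sum (λ i → a i * y x ^ e i))
      ≡⟨ sum-cong-≗ (λ x → ≡.trans (*-distribˡ-sum (w x) (λ i → a i * y x ^ e i))
      (sum-cong-≗ (λ i → lem (w x) (a i) (y x ^ e i)))) ⟩
    sum (λ x → sum (λ i → a i * (w x * y x ^ e i)))
      ≡⟨ ∑-comm (λ x i → a i * (w x * y x ^ e i)) ⟩
    sum (λ i → sum (λ x → a i * (w x * y x ^ e i)))
      ≡⟨ sum-cong-≗ (λ i → *-distribˡ-sum (a i) (λ x → w x * y x ^ e i)) ⟨
    sum (λ i → a i * sum (λ x → w x * y x ^ e i))       ∎
    where
    open ≡.≡-Reasoning
    lem : ∀ w a z → w * (a * z) ≡ a * (w * z)
    lem = solve 3 (λ w a z → w :* (a :* z) := a :* (w :* z)) ≡.refl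

  sum-only : ∀ {k} (t : Fin (suc k) → Carrier) i → (∀ j → j ≢ i → t j ≡ 0#) → sum t ≡ t i
  sum-only {k} t i H = ≡.trans (sum-remove {i = i} t) (≡.trans (≡.cong (λ z → t i + z)
    (≡.trans (sum-cong-≗ (λ j → H (punchIn i j) (Fin.punchInᵢ≢i i j))) (sum-replicate-zero k)))
      (+-identityʳ (t i)))

  coefficient≢0 : ∀ H b → IsInterpolation H b → ∀ i₀ j → toℕ i₀ ℕ.+ j ≡ q′ → 0 < toℕ i₀ → b i₀ ≢ 0#
    →
    sum (λ x → elem x ^ j * H (elem x)) ≢ 0#
  coefficient≢0 H b I i₀ j e 0<i₀ b≢0 vanish = sum-x^[q-1]≢0
    (ℕ.<-≤-trans 0<i₀ (≡.subst (toℕ i₀ ≤_) e (ℕ.m≤m+n (toℕ i₀) j)))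
    (no-zero-divisors b≢0 (begin
      b i₀ * sum (λ x → elem x ^ q′)
        ≡⟨ ≡.cong (b i₀ *_) (sum-cong-≗
          (λ x → ≡.trans (≡.cong (elem x ^_) (≡.sym (≡.trans (ℕ.+-comm j (toℕ i₀)) e)))
          (^-homo-* (elem x) j (toℕ i₀)))) ⟩
      b i₀ * sum (λ x → elem x ^ j * elem x ^ toℕ i₀)
        ≡⟨ sum-only (λ i → b i * sum (λ x → elem x ^ j * elem x ^ toℕ i)) i₀ other ⟨
      sum (λ i → b i * sum (λ x → elem x ^ j * elem x ^ toℕ i))
        ≡⟨ weighted-sum (λ x → elem x ^ j) elem b toℕ ⟨
      sum (λ x → elem x ^ j * sum (λ i → b i * elem x ^ toℕ i))
        ≡⟨ sum-cong-≗ (λ x → ≡.cong (elem x ^ j *_) (interpolate H b I (elem x))) ⟨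
      sum (λ x → elem x ^ j * H (elem x))
        ≡⟨ vanish ⟩
      0# ∎))
    where
    open ≡.≡-Reasoning
    other : ∀ i → i ≢ i₀ → b i * sum (λ x → elem x ^ j * elem x ^ toℕ i) ≡ 0#
    other i i≢i₀ = ≡.trans (≡.cong (b i *_) (≡.trans
      (sum-cong-≗ (λ x → ≡.trans (≡.sym (^-homo-* (elem x) j (toℕ i)))
        (≡.cong (elem x ^_) (ℕ.+-comm j (toℕ i)))))
      (sum-x^[i+j]≡0 (toℕ i₀) j e 0<i₀ (toℕ i) (ℕ.s≤s⁻¹ (Fin.toℕ<n i))
        (λ t → i≢i₀ (Fin.toℕ-injective t))))) (zeroʳ (b i))

  degree-bound : ∀ F → Planar F → ∀ half → h ≡ half ℕ.+ half → ∀ G a b → IsInterpolation G a →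
    IsInterpolation (G ∘ F) b →
    2 ℕ.* degAlg K p b ≤ 2 ℕ.* degAlg K p a ℕ.+ n ℕ.* h
  degree-bound F F-planar half h-even G a b Ia Ib = B.degAlg-least bound
    where
    module A′ = AlgebraicDegree K p a
    module B = AlgebraicDegree K p b
    d = degAlg K p a
    bound : ∀ i → b i ≢ 0# → 2 ℕ.* s p (toℕ i) ≤ 2 ℕ.* d ℕ.+ n ℕ.* h
    bound i b≢0 with 2 ℕ.* s p (toℕ i) ℕ.≤? 2 ℕ.* d ℕ.+ n ℕ.* h
    ... | yes le = le
    ... | no ≰ = ⊥-elim (coefficient≢0 (G ∘ F) b Ib i j e (positive (toℕ i) exceeds) b≢0 (begin
        sum (λ x → elem x ^ j * G (F (elem x)))
          ≡⟨ sum-cong-≗ (λ x → ≡.cong (elem x ^ j *_) (interpolate G a Ia (F (elem x)))) ⟩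
        sum (λ x → elem x ^ j * sum (λ k → a k * F (elem x) ^ toℕ k))
          ≡⟨ weighted-sum (λ x → elem x ^ j) (F ∘ elem) a toℕ ⟩
        sum (λ k → a k * sum (λ x → elem x ^ j * F (elem x) ^ toℕ k))
          ≡⟨ sum-cong-≗ (λ k → term≡0 k (a k ≟ 0#)) ⟩
        sum {q} (λ _ → 0#)
          ≡⟨ sum-replicate-zero q ⟩
        0# ∎))
      where
      open ≡.≡-Reasoning
      j = q′ ∸ toℕ i
      e : toℕ i ℕ.+ j ≡ q′
      e = ℕ.m+[n∸m]≡n (ℕ.s≤s⁻¹ (Fin.toℕ<n i))
      exceeds : 2 ℕ.* d ℕ.+ n ℕ.* h < 2 ℕ.* s p (toℕ i)
      exceeds = ℕ.≰⇒> ≰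
      -- The digit sum of 0 is 0, so an exponent violating the bound is positive, as `coefficient≢0`
      -- requires.
      positive : ∀ k → 2 ℕ.* d ℕ.+ n ℕ.* h < 2 ℕ.* s p k → 0 < k
      positive (suc k) _ = s≤s z≤n
      -- With `s(j) = n h - s(i)`, twice `s(j) + s(k)` is at most `2 n h - 2 s(i) + 2 d`, which
      -- `exceeds` puts below `n h`.
      small : ∀ k → s p k ≤ d → (s p j ℕ.+ s p k) ℕ.+ (s p j ℕ.+ s p k) < n ℕ.* h
      small k sk≤d = arithmetic (s p (toℕ i)) (s p j) (s p k) d (n ℕ.* h) (s-complement (toℕ i) j e)
        sk≤d exceeds
        where
        arithmetic : ∀ x y z d N → x ℕ.+ y ≡ N → z ≤ d → 2 ℕ.* d ℕ.+ N < 2 ℕ.* x → (y ℕ.+ z) ℕ.+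
          (y ℕ.+ z) < N
        arithmetic x y z d N x+y≡N z≤d lt = ℕ.+-cancelʳ-< (2 ℕ.* x) _ _ (ℕ.≤-<-trans
          (ℕ.≤-trans (ℕ.≤-reflexive (l₁ x y z))
            (ℕ.≤-trans (ℕ.+-monoˡ-≤ (2 ℕ.* (x ℕ.+ y)) (ℕ.*-monoʳ-≤ 2 z≤d))
            (ℕ.≤-reflexive (≡.trans (≡.cong (λ t → 2 ℕ.* d ℕ.+ 2 ℕ.* t) x+y≡N) (l₂ d N)))))
          (ℕ.+-monoʳ-< N lt))
          where
          l₁ : ∀ x y z → (y ℕ.+ z) ℕ.+ (y ℕ.+ z) ℕ.+ 2 ℕ.* x ≡ 2 ℕ.* z ℕ.+ 2 ℕ.* (x ℕ.+ y)
          l₁ = ℕS.solve-∀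
          l₂ : ∀ d N → 2 ℕ.* d ℕ.+ 2 ℕ.* N ≡ N ℕ.+ (2 ℕ.* d ℕ.+ N)
          l₂ = ℕS.solve-∀
      term≡0 : ∀ k → Dec (a k ≡ 0#) → a k * sum (λ x → elem x ^ j * F (elem x) ^ toℕ k) ≡ 0#
      term≡0 k (yes a≡0) = ≡.trans (≡.cong (_* sum (λ x → elem x ^ j * F (elem x) ^ toℕ k)) a≡0)
        (zeroˡ _)
      term≡0 k (no a≢0) = ≡.trans
        (≡.cong (a k *_) (Graph.moment F F-planar half h-even j (toℕ k)
        (small (toℕ k) (A′.degAlg-upper k a≢0)))) (zeroʳ (a k))

-- Excluding the prime 2, and conclusion.

-- For the shift 1, the values of the difference map at 0 and 1 differ by `2 (F 0 - F 1)`, which is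
-- zero here, so the map is not injective.
no-planar-char2 : ∀ {q′} (K : FiniteField (suc q′)) (let open FiniteField K) → 1# + 1# ≡ 0# → ∀ F →
  ¬ Planar F
no-planar-char2 K 1+1≡0 F F-planar = 0≢1 (proj₁ (F-planar 1# (λ e → 0≢1 (≡.sym e))) {0#} {1#} (begin
  F (0# + 1#) - F 0# - F 1#    ≡⟨ ≡.cong (λ z → F z - F 0# - F 1#) (+-identityˡ 1#) ⟩
  F 1# - F 0# - F 1#           ≡⟨ lem (F 1#) (F 0#) ⟩
  F 0# - F 1# - F 1# + ((F 1# + F 1#) - (F 0# + F 0#))
    ≡⟨ ≡.cong₂ (λ s t → F 0# - F 1# - F 1# + (s - t)) (double (F 1#)) (double (F 0#)) ⟩
  F 0# - F 1# - F 1# + (0# - 0#)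
    ≡⟨ ≡.trans (≡.cong (λ z → F 0# - F 1# - F 1# + z) (-‿inverseʳ 0#)) (+-identityʳ _) ⟩
  F 0# - F 1# - F 1#           ≡⟨ ≡.cong (λ z → F z - F 1# - F 1#) 1+1≡0 ⟨
  F (1# + 1#) - F 1# - F 1#    ∎))
  where
  open Field K
  open IntegerMorphism.Solver R using (solve; _:=_; _:+_; _:*_; :-_)
  open ≡.≡-Reasoning
  double : ∀ x → x + x ≡ 0#
  double x = ≡.trans (≡.cong₂ _+_ (≡.sym (*-identityˡ x)) (≡.sym (*-identityˡ x)))
    (≡.trans (≡.sym (distribʳ x 1# 1#)) (≡.trans (≡.cong (_* x) 1+1≡0) (zeroˡ x)))
  lem : ∀ a b → a - b - a ≡ b - a - a + ((a + a) - (b + b))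
  lem = solve 2 (λ a b → a :+ :- b :+ :- a := b :+ :- a :+ :- a :+ ((a :+ a) :+ :- (b :+ b))) ≡.refl

parity : ∀ k → (∃ λ j → k ≡ j ℕ.+ j) ⊎ (∃ λ j → k ≡ suc (j ℕ.+ j))
parity zero = inj₁ (0 , ≡.refl)
parity (suc k) with parity k
... | inj₁ (j , e) = inj₂ (j , ≡.cong suc e)
... | inj₂ (j , e) = inj₁ (suc j , ≡.cong suc (≡.trans e (≡.sym (ℕ.+-suc j j))))

2+2j-prime : ∀ j → Prime (suc (suc (j ℕ.+ j))) → j ≡ 0
2+2j-prime j pr with prime⇒irreducible pr (ℕ∣.divides (suc j) (lem j))
  where
  lem : ∀ j → suc (suc (j ℕ.+ j)) ≡ suc j ℕ.* 2
  lem = ℕS.solve-∀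
2+2j-prime zero pr | inj₂ e = ≡.refl
2+2j-prime (suc j) pr | inj₂ ()

-- The order is a variable `q` with an equation instead of `p ^ n`, so that it can be matched as a
-- successor. Parity of `p - 1` separates the odd primes from 2.
planar-degree : ∀ p n → Prime p → ∀ q → q ≡ p ℕ.^ n → (K : FiniteField q) (let open FiniteField K) →
  ∀ F → Planar F → ∀ G a b → IsInterpolation G a → IsInterpolation (G ∘ F) b →
  2 ℕ.* degAlg K p b ≤ 2 ℕ.* degAlg K p a ℕ.+ n ℕ.* (p ∸ 1)
planar-degree zero n pr = ⊥-elim (¬prime[0] pr)
planar-degree (suc zero) n pr = ⊥-elim (¬prime[1] pr)
planar-degree p@(suc (suc m)) n pr zero e K = ⊥-elim (ℕ.<-irrefl e (ℕ.m^n>0 p n))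
planar-degree p@(suc (suc m)) n pr (suc q′) e K F F-planar G a b Ia Ib with parity (suc m)
... | inj₁ (half , h-even) = Moments.degree-bound K m n pr e F F-planar half h-even G a b Ia Ib
... | inj₂ (j , h-odd) = ⊥-elim (no-planar-char2 K char2 F F-planar)
  where
  open Field K
  p≡2 : p ≡ 2
  p≡2 = ≡.trans (≡.cong suc h-odd)
    (≡.cong (λ j → suc (suc (j ℕ.+ j))) (2+2j-prime j (≡.subst Prime (≡.cong suc h-odd) pr)))
  char2 : 1# + 1# ≡ 0#
  char2 = ≡.trans (≡.cong (λ z → 1# + z) (≡.sym (+-identityʳ 1#)))
    (≡.trans (≡.cong (_· 1#) (≡.sym p≡2)) (char-p p n e))

open import Data.Nat using (_^_; _*_; _+_)

theorem1 : (p n : ℕ) → Prime p → 1 ≤ n →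
    (K : FiniteField (p ^ n)) →
    (F : FiniteField.Carrier K → FiniteField.Carrier K) → FiniteField.Planar K F →
    (G : FiniteField.Carrier K → FiniteField.Carrier K) → FiniteField.NonZeroFunction K G →
    (a b : Fin (p ^ n) → FiniteField.Carrier K) →
    FiniteField.IsInterpolation K G a → FiniteField.IsInterpolation K (G ∘ F) b →
    2 * degAlg K p b ≤ 2 * degAlg K p a + n * (p ∸ 1)
theorem1 p n p-prime _ K F F-planar G _ = planar-degree p n p-prime (p ^ n) ≡.refl K F F-planar G
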